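{- Let $P$ be the Petersen graph, i.e. the complement of the line graph of $K_5$, and for $k\ge 2$ let $P^{\square k}$ be its $k$-th Cartesian power, with $n=10^k$ vertices. Then $$\mathrm{rw}\left(P^{\square k}\right)\;\ge\;\frac{2}{81}\cdot\frac{10^k}{k^2}\;=\;n^{1-\Theta\left(\frac{\log k}{k}\right)}.$$
   Context: $H^{\square k}$ is the $k$-th Cartesian power of $H$: its vertices are $k$-tuples of vertices of $H$, two being adjacent iff they differ in exactly one coordinate and are adjacent in $H$ in that coordinate. The asymptotic notation in the exponent is as $k\to\infty$ and describes the lower-bound expression. Rank-width: for a graph $G=(V,E)$ and $X\subseteq V$, the cut-rank $\rho_G(X)$ is the $\mathbb F_2$-rank of the $0$-$1$ adjacency matrix with rows indexed by $X$ and columns by $V\setminus X$. A rank-decomposition is a pair $(T,L)$ with $T$ a tree with at least two nodes, all of degree 1 or 3, and $L$ a bijection from $V$ to the leaves of $T$; its width is the maximum over edges $e$ of $T$ of $\rho_G$ of the vertex set corresponding to one side of $T-e$. $\mathrm{rw}(G)$ is the minimum width of a rank-decomposition of $G$. -}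

module Defs where

open import Algebra.Bundles using (CommutativeRing)
open import Data.Bool.Base using (Bool; false; _∧_)
open import Data.Bool.Properties as Bool using (xor-∧-commutativeRing)
open import Data.Fin.Base using (Fin; zero; suc; toℕ; inject₁; fromℕ; finToFun)
open import Data.Fin.Properties as Fin using (_≟_; any?; all?; toℕ-injective; toℕ<n)
open import Data.Fin.Subset using (Subset; inside; outside; _⊆_; Nonempty; ∁; ∣_∣)
open import Data.Fin.Subset.Properties using (_∈?_; _⊆?_; nonempty?; anySubset?)
open import Data.Integer.Base as ℤ using (ℤ; +_; -[1+_])
import Data.Integer.Properties as ℤ
import Data.Integer.Tactic.RingSolver as ℤ-Solver
open import Data.List.Base using (List; []; _∷_; _++_; map; filter; length; lookup; allFin; cartesianProduct; foldr)
open import Data.Nat.Base as ℕ using (ℕ; zero; suc; _≤_; _<_; _⊔_; _^_; z≤n; s≤s; NonZero; NonTrivial; nonTrivial⇒nonZero; nonTrivial⇒n>1; >-nonZero)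
import Data.Nat.Properties as ℕ
import Data.Nat.Tactic.RingSolver as ℕ-Solver
open import Data.Product.Base using (Σ; Σ-syntax; ∃-syntax; _×_; _,_; proj₁)
open import Data.Rational.Base as ℚ using (ℚ; mkℚ; ↥_; ↧_; ↧ₙ_; Positive; 1ℚ; toℚᵘ; fromℚᵘ; *<*)
import Data.Rational.Properties as ℚ
open import Data.Rational.Solver using (module +-*-Solver)
open import Data.Rational.Unnormalised.Base as ℚᵘ using (mkℚᵘ; *≡*)
import Data.Rational.Unnormalised.Properties as ℚᵘ
open import Data.Sum.Base using (_⊎_; inj₁; inj₂; swap)
open import Data.Vec.Base as Vec using ([]; _∷_; tabulate)
open import Function.Base using (_∘_)
open import Function.Bundles using (_⤖_; module Bijection)
open import Function.Definitions using (Injective)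
open import Level using (0ℓ)
open import Relation.Binary.Construct.Closure.ReflexiveTransitive using (Star; ε; _◅_; _◅◅_)
open import Relation.Binary.Core using (Rel)
open import Relation.Binary.Definitions using (Symmetric; Decidable)
open import Relation.Binary.PropositionalEquality using (_≡_; _≢_; refl; sym; trans; cong; cong₂; subst; subst₂)
open import Relation.Nullary.Decidable using (Dec; yes; no; does; ¬?; _×-dec_; _⊎-dec_; map′)
open import Relation.Nullary.Negation using (¬_; contradiction)

record Graph (n : ℕ) : Set₁ where
  field
    _~_    : Rel (Fin n) 0ℓ
    _~?_   : Decidable _~_
    ~-sym  : Symmetric _~_
    ~-irr  : ∀ {u} → ¬ u ~ u

open Graph using (~-sym; ~-irr)

edges : ∀ {n} → Graph n → List (Fin n × Fin n)
edges {n} G = filter (λ (u , v) → (u Fin.<? v) ×-dec (u ~? v))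
                     (cartesianProduct (allFin n) (allFin n))
  where open Graph G

degree : ∀ {n} → Graph n → Fin n → ℕ
degree G u = ∣ tabulate (λ v → does (u ~? v)) ∣
  where open Graph G

complete : ∀ n → Graph n
complete n = record
  { _~_   = _≢_
  ; _~?_  = λ u v → ¬? (u ≟ v)
  ; ~-sym = λ u≢v → u≢v ∘ sym
  ; ~-irr = λ u≢u → u≢u refl
  }

complement : ∀ {n} → Graph n → Graph n
complement G = record
  { _~_   = λ u v → u ≢ v × ¬ u ~ v
  ; _~?_  = λ u v → ¬? (u ≟ v) ×-dec ¬? (u ~? v)
  ; ~-sym = λ (u≢v , u≁v) → u≢v ∘ sym , u≁v ∘ ~-sym G
  ; ~-irr = λ (u≢u , _) → u≢u refl
  }
  where open Graph G using (_~_; _~?_)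

lineGraph : ∀ {n} (G : Graph n) → Graph (length (edges G))
lineGraph {n} G = record
  { _~_   = λ i j → i ≢ j × Meet (lookup (edges G) i) (lookup (edges G) j)
  ; _~?_  = λ i j → ¬? (i ≟ j) ×-dec meet? (lookup (edges G) i) (lookup (edges G) j)
  ; ~-sym = λ (i≢j , m) → i≢j ∘ sym , meet-sym m
  ; ~-irr = λ (i≢i , _) → i≢i refl
  }
  where
  Meet : Rel (Fin n × Fin n) 0ℓ
  Meet (a , b) (c , d) = (a ≡ c ⊎ a ≡ d) ⊎ (b ≡ c ⊎ b ≡ d)

  meet? : Decidable Meet
  meet? (a , b) (c , d) = ((a ≟ c) ⊎-dec (a ≟ d)) ⊎-dec ((b ≟ c) ⊎-dec (b ≟ d))

  meet-sym : Symmetric Meet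
  meet-sym (inj₁ (inj₁ a≡c)) = inj₁ (inj₁ (sym a≡c))
  meet-sym (inj₁ (inj₂ a≡d)) = inj₂ (inj₁ (sym a≡d))
  meet-sym (inj₂ (inj₁ b≡c)) = inj₁ (inj₂ (sym b≡c))
  meet-sym (inj₂ (inj₂ b≡d)) = inj₂ (inj₂ (sym b≡d))

petersen : Graph 10
petersen = complement (lineGraph (complete 5))

-- A vertex x : Fin (n ^ k) stands for the k-tuple finToFun x : Fin k → Fin n;
-- the library's finToFun is a bijection, with inverse funToFin.

infixl 8 _□^_

_□^_ : ∀ {n} → Graph n → (k : ℕ) → Graph (n ^ k)
_□^_ {n} G k = record
  { _~_   = λ x y → ∃[ i ] AdjacentAt (finToFun x) (finToFun y) i
  ; _~?_  = λ x y → any? λ i → (finToFun x i ~? finToFun y i) ×-dec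
                    all? (λ j → ¬→-dec (j ≟ i) (finToFun x j ≟ finToFun y j))
  ; ~-sym = λ (i , xi~yi , same) → i , ~-sym G xi~yi , λ j j≢i → sym (same j j≢i)
  ; ~-irr = λ (_ , xi~xi , _) → ~-irr G xi~xi
  }
  where
  open Graph G using (_~_; _~?_)

  AdjacentAt : (x y : Fin k → Fin n) → Fin k → Set
  AdjacentAt x y i = x i ~ y i × (∀ j → j ≢ i → x j ≡ y j)

  ¬→-dec : ∀ {A B : Set} → Dec A → Dec B → Dec (¬ A → B)
  ¬→-dec (yes a) _       = yes λ ¬a → contradiction a ¬a
  ¬→-dec (no _)  (yes b) = yes λ _ → b
  ¬→-dec (no ¬a) (no ¬b) = no λ f → ¬b (f ¬a)

Reachable : ∀ {n} → Graph n → Rel (Fin n) 0ℓ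
Reachable G = Star (Graph._~_ G)

-- Decided as in Warshall's algorithm: Via k u v says that some walk from
-- u to v has all its interior vertices among the first k.

module _ {n} (G : Graph n) where
  open Graph G using (_~_; _~?_)

  private
    Via : ℕ → Rel (Fin n) 0ℓ
    Via zero    u v = u ≡ v ⊎ u ~ v
    Via (suc k) u v = Via k u v ⊎ (∃[ w ] toℕ w ≡ k × Via k u w × Via k w v)

    via? : ∀ k → Decidable (Via k)
    via? zero    u v = (u ≟ v) ⊎-dec (u ~? v)
    via? (suc k) u v = via? k u v ⊎-dec
      any? (λ w → (toℕ w ℕ.≟ k) ×-dec via? k u w ×-dec via? k w v)

    sound : ∀ k {u v} → Via k u v → Reachable G u v
    sound zero    (inj₁ refl)            = ε
    sound zero    (inj₂ u~v)             = u~v ◅ ε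
    sound (suc k) (inj₁ p)               = sound k p
    sound (suc k) (inj₂ (_ , _ , p , q)) = sound k p ◅◅ sound k q

    via-trans : ∀ k {u v w} → toℕ w < k → Via k u w → Via k w v → Via k u v
    via-trans (suc k) {w = w} (s≤s w≤k) p q with toℕ w ℕ.≟ k
    ... | yes w≡k = inj₂ (w , w≡k , before p , after q)
      where
      before : ∀ {u} → Via (suc k) u w → Via k u w
      before (inj₁ r) = r
      before (inj₂ (z , z≡k , r , _)) =
        subst (Via k _) (toℕ-injective (trans z≡k (sym w≡k))) r
      after : ∀ {v} → Via (suc k) w v → Via k w v
      after (inj₁ r) = r
      after (inj₂ (z , z≡k , _ , r)) =
        subst (λ z → Via k z _) (toℕ-injective (trans z≡k (sym w≡k))) r
    ... | no w≢k with ℕ.≤∧≢⇒< w≤k w≢k | p | q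
    ... | w<k | inj₁ r | inj₁ s = inj₁ (via-trans k w<k r s)
    ... | w<k | inj₁ r | inj₂ (z , z≡k , s , t) =
      inj₂ (z , z≡k , via-trans k w<k r s , t)
    ... | w<k | inj₂ (z , z≡k , r , s) | inj₁ t =
      inj₂ (z , z≡k , r , via-trans k w<k s t)
    ... | w<k | inj₂ (z , z≡k , r , _) | inj₂ (z′ , z′≡k , _ , t) =
      inj₂ (z , z≡k , r ,
            subst (λ z → Via k z _) (toℕ-injective (trans z′≡k (sym z≡k))) t)

    direct : ∀ k {u v} → Via 0 u v → Via k u v
    direct zero    p = p
    direct (suc k) p = inj₁ (direct k p)

    complete′ : ∀ {u v} → Reachable G u v → Via n u v
    complete′ ε = direct n (inj₁ refl)
    complete′ (_◅_ {j = w} u~w w⋯v) =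
      via-trans n (toℕ<n w) (direct n (inj₂ u~w)) (complete′ w⋯v)

  reachable? : Decidable (Reachable G)
  reachable? u v = map′ (sound n) complete′ (via? n u v)

Connected : ∀ {n} → Graph n → Set
Connected G = ∀ u v → Reachable G u v

record Cycle {n} (G : Graph n) : Set where
  open Graph G using (_~_)
  field
    {m}       : ℕ
    vertex    : Fin (3 ℕ.+ m) → Fin n
    injective : Injective _≡_ _≡_ vertex
    step      : ∀ i → vertex (inject₁ i) ~ vertex (suc i)
    close     : vertex (fromℕ _) ~ vertex zero

IsTree : ∀ {n} → Graph n → Set
IsTree G = Connected G × ¬ Cycle G

deleteEdge : ∀ {n} → Graph n → Fin n × Fin n → Graph n
deleteEdge {n} G (a , b) = record
  { _~_   = λ u v → u ~ v × ¬ Same u v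
  ; _~?_  = λ u v → (u ~? v) ×-dec
              ¬? (((u ≟ a) ×-dec (v ≟ b)) ⊎-dec ((u ≟ b) ×-dec (v ≟ a)))
  ; ~-sym = λ (u~v , ¬same) → ~-sym G u~v , ¬same ∘ same-sym
  ; ~-irr = λ (u~u , _) → ~-irr G u~u
  }
  where
  open Graph G using (_~_; _~?_)

  Same : Rel (Fin n) 0ℓ
  Same u v = (u ≡ a × v ≡ b) ⊎ (u ≡ b × v ≡ a)

  same-sym : Symmetric Same
  same-sym (inj₁ (p , q)) = inj₂ (q , p)
  same-sym (inj₂ (p , q)) = inj₁ (q , p)

-- Rank over 𝔽₂, represented by Bool with _xor_ as addition and _∧_ as
-- multiplication

open import Algebra.Properties.CommutativeMonoid.Sum
  (CommutativeRing.+-commutativeMonoid xor-∧-commutativeRing) public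
  using () renaming (sum to ∑₂)

Matrix₂ : ℕ → ℕ → Set
Matrix₂ m n = Fin m → Fin n → Bool

-- A linear combination of rows over 𝔽₂ is the sum of a subset of them.

rowSum : ∀ {m n} → Matrix₂ m n → Subset m → Fin n → Bool
rowSum M C j = ∑₂ λ i → Vec.lookup C i ∧ M i j

DependentRows : ∀ {m n} → Matrix₂ m n → Subset m → Set
DependentRows M S = ∃[ C ] C ⊆ S × Nonempty C × (∀ j → rowSum M C j ≡ false)

dependentRows? : ∀ {m n} (M : Matrix₂ m n) S → Dec (DependentRows M S)
dependentRows? M S = anySubset? λ C →
  (C ⊆? S) ×-dec nonempty? C ×-dec all? (λ j → rowSum M C j Bool.≟ false)

subsets : ∀ n → List (Subset n)
subsets zero    = [] ∷ []
subsets (suc n) = map (outside ∷_) (subsets n) ++ map (inside ∷_) (subsets n)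

maximum : List ℕ → ℕ
maximum = foldr _⊔_ 0

rank₂ : ∀ {m n} → Matrix₂ m n → ℕ
rank₂ {m} M = maximum (map ∣_∣ (filter (λ S → ¬? (dependentRows? M S)) (subsets m)))

elements : ∀ {n} → Subset n → List (Fin n)
elements {n} X = filter (_∈? X) (allFin n)

cutRank : ∀ {n} → Graph n → Subset n → ℕ
cutRank G X = rank₂ {length (elements X)} {length (elements (∁ X))} λ i j →
  does (lookup (elements X) i ~? lookup (elements (∁ X)) j)
  where open Graph G

record RankDecomposition {n} (G : Graph n) : Set₁ where
  field
    order   : ℕ
    tree    : Graph order
    order≥2 : 2 ≤ order
    isTree  : IsTree tree
    cubic   : ∀ t → degree tree t ≡ 1 ⊎ degree tree t ≡ 3

  Leaf : Set
  Leaf = Σ[ t ∈ Fin order ] degree tree t ≡ 1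

  field
    L : Fin n ⤖ Leaf

  node : Fin n → Fin order
  node v = proj₁ (Bijection.to L v)

  side : Fin order × Fin order → Subset n
  side (a , b) = tabulate λ v → does (reachable? (deleteEdge tree (a , b)) a (node v))

  width : ℕ
  width = maximum (map (λ e → cutRank G (side e)) (edges tree))

IsRankWidth : ∀ {n} → Graph n → ℕ → Set₁
IsRankWidth G r = (Σ[ D ∈ RankDecomposition G ] width D ≡ r)
                × (∀ (D : RankDecomposition G) → r ≤ width D)
  where open RankDecomposition

record ℝ : Set₁ where
  field
    lower upper     : ℚ → Set
    lower-inhabited : ∃[ q ] lower q
    upper-inhabited : ∃[ q ] upper q
    lower-closed    : ∀ {q r} → q ℚ.< r → lower r → lower q
    upper-closed    : ∀ {q r} → q ℚ.< r → upper q → upper r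
    lower-open      : ∀ {q} → lower q → ∃[ r ] q ℚ.< r × lower r
    upper-open      : ∀ {r} → upper r → ∃[ q ] q ℚ.< r × upper q
    disjoint        : ∀ {q} → ¬ (lower q × upper q)
    located         : ∀ {q r} → q ℚ.< r → lower q ⊎ upper r

open ℝ

infix 4 _≤ᴿ_

_≤ᴿ_ : ℝ → ℝ → Set
x ≤ᴿ y = ∀ {q} → lower x q → lower y q

infix 8 1-_

1-_ : ℝ → ℝ
1- x = record
  { lower           = upper x ∘ 1-ℚ_
  ; upper           = lower x ∘ 1-ℚ_
  ; lower-inhabited = let q , u = upper-inhabited x in 1-ℚ q , subst (upper x) (sym (invol q)) u
  ; upper-inhabited = let q , l = lower-inhabited x in 1-ℚ q , subst (lower x) (sym (invol q)) l
  ; lower-closed    = λ q<r → upper-closed x (anti q<r)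
  ; upper-closed    = λ q<r → lower-closed x (anti q<r)
  ; lower-open      = λ {q} u → let s , s<1-q , u′ = upper-open x u in
      1-ℚ s , subst (ℚ._< 1-ℚ s) (invol q) (anti s<1-q) , subst (upper x) (sym (invol s)) u′
  ; upper-open      = λ {r} l → let s , 1-r<s , l′ = lower-open x l in
      1-ℚ s , subst (1-ℚ s ℚ.<_) (invol r) (anti 1-r<s) , subst (lower x) (sym (invol s)) l′
  ; disjoint        = λ (u , l) → disjoint x (l , u)
  ; located         = λ q<r → swap (located x (anti q<r))
  }
  where
  1-ℚ_ : ℚ → ℚ
  1-ℚ q = 1ℚ ℚ.- q

  invol : ∀ q → 1-ℚ (1-ℚ q) ≡ q
  invol = solve 1 (λ q → con 1ℚ :- (con 1ℚ :- q) := q) refl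
    where open +-*-Solver

  anti : ∀ {q r} → q ℚ.< r → 1-ℚ r ℚ.< 1-ℚ q
  anti q<r = ℚ.+-monoʳ-< 1ℚ (ℚ.neg-antimono-< q<r)

infixr 7 _·_

_·_ : (c : ℚ) .{{_ : Positive c}} → ℝ → ℝ
c · x = record
  { lower           = lower x ∘ ÷c
  ; upper           = upper x ∘ ÷c
  ; lower-inhabited = let q , l = lower-inhabited x in q ℚ.* c , subst (lower x) (sym (*c÷c q)) l
  ; upper-inhabited = let q , u = upper-inhabited x in q ℚ.* c , subst (upper x) (sym (*c÷c q)) u
  ; lower-closed    = λ q<r → lower-closed x (÷c-mono q<r)
  ; upper-closed    = λ q<r → upper-closed x (÷c-mono q<r)
  ; lower-open      = λ {q} l → let s , q÷c<s , l′ = lower-open x l in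
      s ℚ.* c , subst (ℚ._< s ℚ.* c) (÷c*c q) (ℚ.*-monoˡ-<-pos c q÷c<s)
              , subst (lower x) (sym (*c÷c s)) l′
  ; upper-open      = λ {r} u → let s , s<r÷c , u′ = upper-open x u in
      s ℚ.* c , subst (s ℚ.* c ℚ.<_) (÷c*c r) (ℚ.*-monoˡ-<-pos c s<r÷c)
              , subst (upper x) (sym (*c÷c s)) u′
  ; disjoint        = disjoint x
  ; located         = λ q<r → located x (÷c-mono q<r)
  }
  where
  instance
    _ = ℚ.pos⇒nonZero c
    _ = ℚ.1/pos⇒pos c

  ÷c : ℚ → ℚ
  ÷c q = q ℚ.÷ c

  *c÷c : ∀ q → ÷c (q ℚ.* c) ≡ q
  *c÷c q = trans (ℚ.*-assoc q c _) (trans (cong (q ℚ.*_) (ℚ.*-inverseʳ c)) (ℚ.*-identityʳ q))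

  ÷c*c : ∀ q → ÷c q ℚ.* c ≡ q
  ÷c*c q = trans (ℚ.*-assoc q _ c) (trans (cong (q ℚ.*_) (ℚ.*-inverseˡ c)) (ℚ.*-identityʳ q))

  ÷c-mono : ∀ {q r} → q ℚ.< r → ÷c q ℚ.< ÷c r
  ÷c-mono = ℚ.*-monoˡ-<-pos (ℚ.1/ c)

infix 9 _⁺ _⁻

_⁺ _⁻ : ℤ → ℕ
(+ n)    ⁺ = n
-[1+ _ ] ⁺ = 0
i        ⁻ = (ℤ.- i) ⁺

-- For q = p / d and x = u / v, the real number b ^ q is compared with x
-- by comparing b ^ p with x ^ d, the denominators being cleared:
-- b ^ p⁺ * v ^ d against u ^ d * b ^ p⁻.

powSide ratSide : ℕ → ℚ → ℚ → ℕ
powSide b q x = b ℕ.^ (↥ q) ⁺ ℕ.* ↧ₙ x ℕ.^ ↧ₙ q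
ratSide b q x = ℤ.∣ ↥ x ∣ ℕ.^ ↧ₙ q ℕ.* b ℕ.^ (↥ q) ⁻

PowerBelow PowerAbove : ℕ → ℚ → (x : ℚ) .{{_ : Positive x}} → Set
PowerBelow b q x = powSide b q x ℕ.< ratSide b q x
PowerAbove b q x = ratSide b q x ℕ.< powSide b q x

-- x = b ^ y, where b ^ y is determined by the rational powers b ^ q with
-- q < y and those with q > y.

IsPower : (x : ℚ) .{{_ : Positive x}} → ℕ → ℝ → Set
IsPower x b y = (∀ {q} → lower y q → PowerBelow b q x) × (∀ {q} → upper y q → PowerAbove b q x)

n<b^n : ∀ b → 1 ℕ.< b → ∀ n → n ℕ.< b ℕ.^ n
n<b^n b 1<b zero    = s≤s z≤n
n<b^n b 1<b (suc n) = ℕ.≤-<-trans (n<b^n b 1<b n) (ℕ.^-monoʳ-< b 1<b (ℕ.n<1+n n))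

bernoulli : ∀ a n → a ℕ.^ suc n ℕ.+ suc n ℕ.* a ℕ.^ n ℕ.≤ suc a ℕ.^ suc n
bernoulli a zero    = ℕ.≤-reflexive (lemma a)
  where
  lemma : ∀ a → a ℕ.* 1 ℕ.+ 1 ≡ suc a ℕ.* 1
  lemma = ℕ-Solver.solve-∀
bernoulli a (suc n) = begin
  a ℕ.* A ℕ.+ (2 ℕ.+ n) ℕ.* A               ≡⟨ lemma₁ a A n ⟩
  A ℕ.+ (a ℕ.* A ℕ.+ suc n ℕ.* A)           ≡⟨ cong (λ t → A ℕ.+ (a ℕ.* A ℕ.+ t)) (lemma₂ a (a ℕ.^ n) n) ⟩
  A ℕ.+ (a ℕ.* A ℕ.+ a ℕ.* B)               ≡⟨ cong (A ℕ.+_) (ℕ.*-distribˡ-+ a A B) ⟨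
  A ℕ.+ a ℕ.* (A ℕ.+ B)                     ≤⟨ ℕ.+-mono-≤ (ℕ.≤-trans (ℕ.m≤m+n A B) (bernoulli a n)) (ℕ.*-monoʳ-≤ a (bernoulli a n)) ⟩
  suc a ℕ.^ suc n ℕ.+ a ℕ.* suc a ℕ.^ suc n ∎
  where
  open ℕ.≤-Reasoning
  A = a ℕ.^ suc n
  B = suc n ℕ.* a ℕ.^ n
  lemma₁ : ∀ a A n → a ℕ.* A ℕ.+ (2 ℕ.+ n) ℕ.* A ≡ A ℕ.+ (a ℕ.* A ℕ.+ suc n ℕ.* A)
  lemma₁ = ℕ-Solver.solve-∀
  lemma₂ : ∀ a C n → suc n ℕ.* (a ℕ.* C) ≡ a ℕ.* (suc n ℕ.* C)
  lemma₂ = ℕ-Solver.solve-∀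

outgrow : ∀ b {a c} .{{_ : NonZero a}} → a ℕ.< c → ∃[ N ] b ℕ.* a ℕ.^ suc N ℕ.< c ℕ.^ suc N
outgrow b {a} {c} a<c = N , (begin-strict
  b ℕ.* (a ℕ.* P)           ≡⟨ ℕ.*-assoc b a P ⟨
  N ℕ.* P                   <⟨ ℕ.*-monoˡ-< P {{ℕ.m^n≢0 a N}} (ℕ.n<1+n N) ⟩
  suc N ℕ.* P               ≤⟨ ℕ.m≤n+m (suc N ℕ.* P) (a ℕ.* P) ⟩
  a ℕ.* P ℕ.+ suc N ℕ.* P   ≤⟨ bernoulli a N ⟩
  suc a ℕ.^ suc N           ≤⟨ ℕ.^-monoˡ-≤ (suc N) a<c ⟩
  c ℕ.^ suc N               ∎)
  where
  open ℕ.≤-Reasoning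
  N = b ℕ.* a
  P = a ℕ.^ N

^-distrib-* : ∀ a c n → (a ℕ.* c) ℕ.^ n ≡ a ℕ.^ n ℕ.* c ℕ.^ n
^-distrib-* a c zero    = refl
^-distrib-* a c (suc n) =
  trans (cong (a ℕ.* c ℕ.*_) (^-distrib-* a c n)) (lemma a c (a ℕ.^ n) (c ℕ.^ n))
  where
  lemma : ∀ a c x y → a ℕ.* c ℕ.* (x ℕ.* y) ≡ a ℕ.* x ℕ.* (c ℕ.* y)
  lemma = ℕ-Solver.solve-∀

pos-neg : ∀ i → + (i ⁺) ℤ.- + (i ⁻) ≡ i
pos-neg (+ zero)  = refl
pos-neg (+ suc n) = ℤ.+-identityʳ _
pos-neg -[1+ n ]  = refl

toCross : ∀ m m′ e M M′ d →
          (+ m ℤ.- + m′) ℤ.* + e ℤ.+ (+ m′ ℤ.* + e ℤ.+ + M′ ℤ.* + d) ≡ + (m ℕ.* e ℕ.+ M′ ℕ.* d)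
          × (+ M ℤ.- + M′) ℤ.* + d ℤ.+ (+ m′ ℤ.* + e ℤ.+ + M′ ℤ.* + d) ≡ + (M ℕ.* d ℕ.+ m′ ℕ.* e)
toCross m m′ e M M′ d =
  trans (ring₁ (+ m) (+ m′) (+ e) (+ M′) (+ d)) (collect m e M′ d) ,
  trans (ring₂ (+ M) (+ M′) (+ d) (+ m′) (+ e)) (collect M d m′ e)
  where
  ring₁ : ∀ m m′ e M′ d → (m ℤ.- m′) ℤ.* e ℤ.+ (m′ ℤ.* e ℤ.+ M′ ℤ.* d) ≡ m ℤ.* e ℤ.+ M′ ℤ.* d
  ring₁ = ℤ-Solver.solve-∀
  ring₂ : ∀ M M′ d m′ e → (M ℤ.- M′) ℤ.* d ℤ.+ (m′ ℤ.* e ℤ.+ M′ ℤ.* d) ≡ M ℤ.* d ℤ.+ m′ ℤ.* e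
  ring₂ = ℤ-Solver.solve-∀
  collect : ∀ a b c d → + a ℤ.* + b ℤ.+ + c ℤ.* + d ≡ + (a ℕ.* b ℕ.+ c ℕ.* d)
  collect a b c d = trans (cong₂ ℤ._+_ (sym (ℤ.pos-* a b)) (sym (ℤ.pos-* c d))) (sym (ℤ.pos-+ (a ℕ.* b) (c ℕ.* d)))

cross-≤ : ∀ m m′ e M M′ d → (+ m ℤ.- + m′) ℤ.* + e ℤ.≤ (+ M ℤ.- + M′) ℤ.* + d →
          m ℕ.* e ℕ.+ M′ ℕ.* d ℕ.≤ M ℕ.* d ℕ.+ m′ ℕ.* e
cross-≤ m m′ e M M′ d h = let l , r = toCross m m′ e M M′ d in
  ℤ.drop‿+≤+ (subst₂ ℤ._≤_ l r (ℤ.+-monoˡ-≤ _ h))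

cross-< : ∀ m m′ e M M′ d → (+ m ℤ.- + m′) ℤ.* + e ℤ.< (+ M ℤ.- + M′) ℤ.* + d →
          m ℕ.* e ℕ.+ M′ ℕ.* d ℕ.< M ℕ.* d ℕ.+ m′ ℕ.* e
cross-< m m′ e M M′ d h = let l , r = toCross m m′ e M M′ d in
  ℤ.drop‿+<+ (subst₂ ℤ._<_ l r (ℤ.+-monoˡ-< _ h))

^-cancelˡ-< : ∀ n {a c} → a ℕ.^ n ℕ.< c ℕ.^ n → a ℕ.< c
^-cancelˡ-< n a^n<c^n = ℕ.≰⇒> λ c≤a → ℕ.<⇒≱ a^n<c^n (ℕ.^-monoˡ-≤ n c≤a)

module Compare (b : ℕ) (1<b : 1 ℕ.< b) (u v : ℕ) (u≢0 : NonZero u) (v≢0 : NonZero v) where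
  open ℕ.≤-Reasoning

  b≢0 : NonZero b
  b≢0 = >-nonZero (ℕ.<-trans (s≤s z≤n) 1<b)

  X Y : ℕ → ℕ → ℕ
  X m d = b ℕ.^ m ℕ.* v ℕ.^ d
  Y m d = u ℕ.^ d ℕ.* b ℕ.^ m

  X≢0 : ∀ m d → NonZero (X m d)
  X≢0 m d = ℕ.m*n≢0 _ _ {{ℕ.m^n≢0 b m {{b≢0}}}} {{ℕ.m^n≢0 v d {{v≢0}}}}

  Y≢0 : ∀ m d → NonZero (Y m d)
  Y≢0 m d = ℕ.m*n≢0 _ _ {{ℕ.m^n≢0 u d {{u≢0}}}} {{ℕ.m^n≢0 b m {{b≢0}}}}

  X^ : ∀ m d n → X m d ℕ.^ n ≡ X (m ℕ.* n) (d ℕ.* n)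
  X^ m d n = trans (^-distrib-* (b ℕ.^ m) (v ℕ.^ d) n)
                   (cong₂ ℕ._*_ (ℕ.^-*-assoc b m n) (ℕ.^-*-assoc v d n))

  Y^ : ∀ m d n → Y m d ℕ.^ n ≡ Y (m ℕ.* n) (d ℕ.* n)
  Y^ m d n = trans (^-distrib-* (u ℕ.^ d) (b ℕ.^ m) n)
                   (cong₂ ℕ._*_ (ℕ.^-*-assoc u d n) (ℕ.^-*-assoc b m n))

  K : ℕ → ℕ
  K n = v ℕ.^ n ℕ.* u ℕ.^ n

  XY : ∀ m d M e → X m d ℕ.^ e ℕ.* Y M e ℕ.^ d ≡ b ℕ.^ (m ℕ.* e ℕ.+ M ℕ.* d) ℕ.* K (d ℕ.* e)
  XY m d M e = begin-equality
    X m d ℕ.^ e ℕ.* Y M e ℕ.^ d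
      ≡⟨ cong₂ ℕ._*_ (X^ m d e) (Y^ M e d) ⟩
    (β ℕ.* v ℕ.^ (d ℕ.* e)) ℕ.* (u ℕ.^ (e ℕ.* d) ℕ.* γ)
      ≡⟨ cong (λ n → (β ℕ.* v ℕ.^ (d ℕ.* e)) ℕ.* (u ℕ.^ n ℕ.* γ)) (ℕ.*-comm e d) ⟩
    (β ℕ.* v ℕ.^ (d ℕ.* e)) ℕ.* (u ℕ.^ (d ℕ.* e) ℕ.* γ)
      ≡⟨ lemma β (v ℕ.^ (d ℕ.* e)) (u ℕ.^ (d ℕ.* e)) γ ⟩
    (β ℕ.* γ) ℕ.* K (d ℕ.* e)
      ≡⟨ cong (ℕ._* K (d ℕ.* e)) (ℕ.^-distribˡ-+-* b (m ℕ.* e) (M ℕ.* d)) ⟨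
    b ℕ.^ (m ℕ.* e ℕ.+ M ℕ.* d) ℕ.* K (d ℕ.* e) ∎
    where
    β = b ℕ.^ (m ℕ.* e)
    γ = b ℕ.^ (M ℕ.* d)
    lemma : ∀ β x y γ → (β ℕ.* x) ℕ.* (y ℕ.* γ) ≡ (β ℕ.* γ) ℕ.* (x ℕ.* y)
    lemma = ℕ-Solver.solve-∀

  XY-sym : ∀ m d M e → b ℕ.^ (m ℕ.* e ℕ.+ M ℕ.* d) ℕ.* K (e ℕ.* d) ≡ X m d ℕ.^ e ℕ.* Y M e ℕ.^ d
  XY-sym m d M e = trans (cong (λ n → b ℕ.^ (m ℕ.* e ℕ.+ M ℕ.* d) ℕ.* K n) (ℕ.*-comm e d)) (sym (XY m d M e))

  XY-≤ : ∀ m m′ d M M′ e → m ℕ.* e ℕ.+ M′ ℕ.* d ℕ.≤ M ℕ.* d ℕ.+ m′ ℕ.* e →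
         X m d ℕ.^ e ℕ.* Y M′ e ℕ.^ d ℕ.≤ X M e ℕ.^ d ℕ.* Y m′ d ℕ.^ e
  XY-≤ m m′ d M M′ e h =
    subst₂ ℕ._≤_ (sym (XY m d M′ e)) (XY-sym M e m′ d) (ℕ.*-monoˡ-≤ (K (d ℕ.* e)) (ℕ.^-monoʳ-≤ b {{b≢0}} h))

  XY-< : ∀ m m′ d M M′ e → m ℕ.* e ℕ.+ M′ ℕ.* d ℕ.< M ℕ.* d ℕ.+ m′ ℕ.* e →
         X m d ℕ.^ e ℕ.* Y M′ e ℕ.^ d ℕ.< X M e ℕ.^ d ℕ.* Y m′ d ℕ.^ e
  XY-< m m′ d M M′ e h =
    subst₂ ℕ._<_ (sym (XY m d M′ e)) (XY-sym M e m′ d)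
      (ℕ.*-monoˡ-< (K (d ℕ.* e)) {{K≢0}} (ℕ.^-monoʳ-< b 1<b h))
    where K≢0 = ℕ.m*n≢0 _ _ {{ℕ.m^n≢0 v (d ℕ.* e) {{v≢0}}}} {{ℕ.m^n≢0 u (d ℕ.* e) {{u≢0}}}}

  below-down : ∀ m m′ d M M′ e .{{_ : NonZero d}} → m ℕ.* e ℕ.+ M′ ℕ.* d ℕ.≤ M ℕ.* d ℕ.+ m′ ℕ.* e →
               X M e ℕ.< Y M′ e → X m d ℕ.< Y m′ d
  below-down m m′ d M M′ e h XM<YM = ^-cancelˡ-< e
    (ℕ.*-cancelʳ-< (Y M′ e ℕ.^ d) _ _ (begin-strict
      X m d ℕ.^ e ℕ.* Y M′ e ℕ.^ d    ≤⟨ XY-≤ m m′ d M M′ e h ⟩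
      X M e ℕ.^ d ℕ.* Y m′ d ℕ.^ e    <⟨ ℕ.*-monoˡ-< (Y m′ d ℕ.^ e) {{ℕ.m^n≢0 (Y m′ d) e {{Y≢0 m′ d}}}} (ℕ.^-monoˡ-< d XM<YM) ⟩
      Y M′ e ℕ.^ d ℕ.* Y m′ d ℕ.^ e   ≡⟨ ℕ.*-comm (Y M′ e ℕ.^ d) _ ⟩
      Y m′ d ℕ.^ e ℕ.* Y M′ e ℕ.^ d   ∎))

  above-up : ∀ m m′ d M M′ e .{{_ : NonZero e}} → m ℕ.* e ℕ.+ M′ ℕ.* d ℕ.≤ M ℕ.* d ℕ.+ m′ ℕ.* e →
             Y m′ d ℕ.< X m d → Y M′ e ℕ.< X M e
  above-up m m′ d M M′ e h Ym<Xm = ^-cancelˡ-< d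
    (ℕ.*-cancelˡ-< (X m d ℕ.^ e) _ _ (begin-strict
      X m d ℕ.^ e ℕ.* Y M′ e ℕ.^ d    ≤⟨ XY-≤ m m′ d M M′ e h ⟩
      X M e ℕ.^ d ℕ.* Y m′ d ℕ.^ e    <⟨ ℕ.*-monoʳ-< (X M e ℕ.^ d) {{ℕ.m^n≢0 (X M e) d {{X≢0 M e}}}} (ℕ.^-monoˡ-< e Ym<Xm) ⟩
      X M e ℕ.^ d ℕ.* X m d ℕ.^ e     ≡⟨ ℕ.*-comm (X M e ℕ.^ d) _ ⟩
      X m d ℕ.^ e ℕ.* X M e ℕ.^ d     ∎))

  beyond : ∀ m m′ d M M′ e → m ℕ.* e ℕ.+ M′ ℕ.* d ℕ.< M ℕ.* d ℕ.+ m′ ℕ.* e →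
           Y m′ d ℕ.≤ X m d → Y M′ e ℕ.< X M e
  beyond m m′ d M M′ e h Ym≤Xm = ^-cancelˡ-< d
    (ℕ.*-cancelˡ-< (X m d ℕ.^ e) _ _ (begin-strict
      X m d ℕ.^ e ℕ.* Y M′ e ℕ.^ d    <⟨ XY-< m m′ d M M′ e h ⟩
      X M e ℕ.^ d ℕ.* Y m′ d ℕ.^ e    ≤⟨ ℕ.*-monoʳ-≤ (X M e ℕ.^ d) (ℕ.^-monoˡ-≤ e Ym≤Xm) ⟩
      X M e ℕ.^ d ℕ.* X m d ℕ.^ e     ≡⟨ ℕ.*-comm (X M e ℕ.^ d) _ ⟩
      X m d ℕ.^ e ℕ.* X M e ℕ.^ d     ∎))

  Below Above : ℚ → Set
  Below q = X ((↥ q) ⁺) (↧ₙ q) ℕ.< Y ((↥ q) ⁻) (↧ₙ q)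
  Above q = Y ((↥ q) ⁻) (↧ₙ q) ℕ.< X ((↥ q) ⁺) (↧ₙ q)

  normal-≡ : ∀ q → + ((↥ q) ⁺) ℤ.- + ((↥ q) ⁻) ≡ ↥ q
  normal-≡ q = pos-neg (↥ q)

  <⇒cross : ∀ {q r} → q ℚ.< r → (↥ q) ⁺ ℕ.* ↧ₙ r ℕ.+ (↥ r) ⁻ ℕ.* ↧ₙ q ℕ.< (↥ r) ⁺ ℕ.* ↧ₙ q ℕ.+ (↥ q) ⁻ ℕ.* ↧ₙ r
  <⇒cross {q} {r} (*<* h) = cross-< ((↥ q) ⁺) ((↥ q) ⁻) (↧ₙ r) ((↥ r) ⁺) ((↥ r) ⁻) (↧ₙ q)
    (subst₂ (λ i j → i ℤ.* ↧ r ℤ.< j ℤ.* ↧ q) (sym (normal-≡ q)) (sym (normal-≡ r)) h)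

  frac : ℕ → ℕ → ℕ → ℚ
  frac m m′ d-1 = fromℚᵘ (mkℚᵘ (+ m ℤ.- + m′) d-1)

  frac-≡ : ∀ m m′ d → let q = frac m m′ d in
           (+ ((↥ q) ⁺) ℤ.- + ((↥ q) ⁻)) ℤ.* + suc d ≡ (+ m ℤ.- + m′) ℤ.* ↧ q
  frac-≡ m m′ d =
    trans (cong (ℤ._* + suc d) (normal-≡ (frac m m′ d)))
          (cross (frac m m′ d) (ℚ.toℚᵘ-fromℚᵘ (mkℚᵘ (+ m ℤ.- + m′) d)))
    where
    cross : ∀ q {i} → toℚᵘ q ℚᵘ.≃ mkℚᵘ i d → ↥ q ℤ.* + suc d ≡ i ℤ.* ↧ q
    cross record{} (*≡* eq) = eq

  frac-below : ∀ m m′ d → X m (suc d) ℕ.< Y m′ (suc d) → Below (frac m m′ d)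
  frac-below m m′ d = below-down ((↥ q) ⁺) ((↥ q) ⁻) (↧ₙ q) m m′ (suc d)
    (cross-≤ ((↥ q) ⁺) ((↥ q) ⁻) (suc d) m m′ (↧ₙ q) (ℤ.≤-reflexive (frac-≡ m m′ d)))
    where q = frac m m′ d

  frac-above : ∀ m m′ d → Y m′ (suc d) ℕ.< X m (suc d) → Above (frac m m′ d)
  frac-above m m′ d = above-up m m′ (suc d) ((↥ q) ⁺) ((↥ q) ⁻) (↧ₙ q)
    (cross-≤ m m′ (↧ₙ q) ((↥ q) ⁺) ((↥ q) ⁻) (suc d) (ℤ.≤-reflexive (sym (frac-≡ m m′ d))))
    where q = frac m m′ d

  Below-closed : ∀ {q r} → q ℚ.< r → Below r → Below q
  Below-closed {q} {r} q<r = below-down ((↥ q) ⁺) ((↥ q) ⁻) (↧ₙ q) ((↥ r) ⁺) ((↥ r) ⁻) (↧ₙ r)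
    (ℕ.<⇒≤ (<⇒cross {q} {r} q<r))

  Above-closed : ∀ {q r} → q ℚ.< r → Above q → Above r
  Above-closed {q} {r} q<r = above-up ((↥ q) ⁺) ((↥ q) ⁻) (↧ₙ q) ((↥ r) ⁺) ((↥ r) ⁻) (↧ₙ r)
    (ℕ.<⇒≤ (<⇒cross {q} {r} q<r))

  locate : ∀ {q r} → q ℚ.< r → Below q ⊎ Above r
  locate {q} {r} q<r with X ((↥ q) ⁺) (↧ₙ q) ℕ.<? Y ((↥ q) ⁻) (↧ₙ q)
  ... | yes l = inj₁ l
  ... | no ¬l = inj₂ (beyond ((↥ q) ⁺) ((↥ q) ⁻) (↧ₙ q) ((↥ r) ⁺) ((↥ r) ⁻) (↧ₙ r)
                             (<⇒cross {q} {r} q<r) (ℕ.≮⇒≥ ¬l))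

  <-frac : ∀ q m m′ d → ↥ q ℤ.* + suc d ℤ.< (+ m ℤ.- + m′) ℤ.* ↧ q → q ℚ.< frac m m′ d
  <-frac q@record{} m m′ d h = ℚ.toℚᵘ-cancel-<
    (ℚᵘ.<-respʳ-≃ (ℚᵘ.≃-sym (ℚ.toℚᵘ-fromℚᵘ (mkℚᵘ (+ m ℤ.- + m′) d))) (ℚᵘ.*<* h))

  frac-< : ∀ q m m′ d → (+ m ℤ.- + m′) ℤ.* ↧ q ℤ.< ↥ q ℤ.* + suc d → frac m m′ d ℚ.< q
  frac-< q@record{} m m′ d h = ℚ.toℚᵘ-cancel-<
    (ℚᵘ.<-respˡ-≃ (ℚᵘ.≃-sym (ℚ.toℚᵘ-fromℚᵘ (mkℚᵘ (+ m ℤ.- + m′) d))) (ℚᵘ.*<* h))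

  scaled : ∀ q N → ↥ q ℤ.* + (↧ₙ q ℕ.* N) ≡ (+ ((↥ q) ⁺) ℤ.- + ((↥ q) ⁻)) ℤ.* (↧ q ℤ.* + N)
  scaled q N = cong₂ ℤ._*_ (sym (normal-≡ q)) (ℤ.pos-* (↧ₙ q) N)

  i<i+↧ : ∀ i q → i ℤ.< i ℤ.+ ↧ q
  i<i+↧ i q = subst (ℤ._< i ℤ.+ ↧ q) (ℤ.+-identityʳ i) (ℤ.+-monoʳ-< i (ℤ.+<+ (s≤s z≤n)))

  nudge-up : ∀ q N → q ℚ.< frac (suc ((↥ q) ⁺ ℕ.* suc N)) ((↥ q) ⁻ ℕ.* suc N) (ℕ.pred (↧ₙ q ℕ.* suc N))
  nudge-up q N = <-frac q (suc (m ℕ.* n)) (m′ ℕ.* n) (ℕ.pred (↧ₙ q ℕ.* n))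
    (subst₂ ℤ._<_ (sym (scaled q n)) (sym eq) (i<i+↧ _ q))
    where
    m = (↥ q) ⁺
    m′ = (↥ q) ⁻
    n = suc N
    ring : ∀ m m′ d n → (+ 1 ℤ.+ m ℤ.* n ℤ.- m′ ℤ.* n) ℤ.* d ≡ (m ℤ.- m′) ℤ.* (d ℤ.* n) ℤ.+ d
    ring = ℤ-Solver.solve-∀
    eq : (+ suc (m ℕ.* n) ℤ.- + (m′ ℕ.* n)) ℤ.* ↧ q ≡ (+ m ℤ.- + m′) ℤ.* (↧ q ℤ.* + n) ℤ.+ ↧ q
    eq = trans (cong₂ (λ i j → (+ 1 ℤ.+ i ℤ.- j) ℤ.* ↧ q) (ℤ.pos-* m n) (ℤ.pos-* m′ n))
               (ring (+ m) (+ m′) (↧ q) (+ n))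

  nudge-down : ∀ q N → frac ((↥ q) ⁺ ℕ.* suc N) (suc ((↥ q) ⁻ ℕ.* suc N)) (ℕ.pred (↧ₙ q ℕ.* suc N)) ℚ.< q
  nudge-down q N = frac-< q (m ℕ.* n) (suc (m′ ℕ.* n)) (ℕ.pred (↧ₙ q ℕ.* n))
    (subst ((+ (m ℕ.* n) ℤ.- + suc (m′ ℕ.* n)) ℤ.* ↧ q ℤ.<_)
           (trans (sym eq) (sym (scaled q n))) (i<i+↧ _ q))
    where
    m = (↥ q) ⁺
    m′ = (↥ q) ⁻
    n = suc N
    ring : ∀ m m′ d n → (m ℤ.- m′) ℤ.* (d ℤ.* n) ≡ (m ℤ.* n ℤ.- (+ 1 ℤ.+ m′ ℤ.* n)) ℤ.* d ℤ.+ d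
    ring = ℤ-Solver.solve-∀
    eq : (+ m ℤ.- + m′) ℤ.* (↧ q ℤ.* + n) ≡ (+ (m ℕ.* n) ℤ.- + suc (m′ ℕ.* n)) ℤ.* ↧ q ℤ.+ ↧ q
    eq = trans (ring (+ m) (+ m′) (↧ q) (+ n))
               (cong₂ (λ i j → (i ℤ.- (+ 1 ℤ.+ j)) ℤ.* ↧ q ℤ.+ ↧ q) (sym (ℤ.pos-* m n)) (sym (ℤ.pos-* m′ n)))

  Below-open : ∀ {q} → Below q → ∃[ r ] q ℚ.< r × Below r
  Below-open {q} l = let N , h = outgrow b {{X≢0 m d}} l in
    frac (suc (m ℕ.* suc N)) (m′ ℕ.* suc N) (ℕ.pred (d ℕ.* suc N)) , nudge-up q N ,
    frac-below (suc (m ℕ.* suc N)) (m′ ℕ.* suc N) (ℕ.pred (d ℕ.* suc N))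
      (subst₂ ℕ._<_
        (trans (cong (b ℕ.*_) (X^ m d (suc N))) (sym (ℕ.*-assoc b (b ℕ.^ (m ℕ.* suc N)) (v ℕ.^ (d ℕ.* suc N)))))
        (Y^ m′ d (suc N)) h)
    where
    m = (↥ q) ⁺
    m′ = (↥ q) ⁻
    d = ↧ₙ q

  Above-open : ∀ {q} → Above q → ∃[ r ] r ℚ.< q × Above r
  Above-open {q} l = let N , h = outgrow b {{Y≢0 m′ d}} l in
    frac (m ℕ.* suc N) (suc (m′ ℕ.* suc N)) (ℕ.pred (d ℕ.* suc N)) , nudge-down q N ,
    frac-above (m ℕ.* suc N) (suc (m′ ℕ.* suc N)) (ℕ.pred (d ℕ.* suc N))
      (subst₂ ℕ._<_
        (trans (cong (b ℕ.*_) (Y^ m′ d (suc N))) (rotate b (u ℕ.^ (d ℕ.* suc N)) (b ℕ.^ (m′ ℕ.* suc N))))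
        (X^ m d (suc N)) h)
    where
    m = (↥ q) ⁺
    m′ = (↥ q) ⁻
    d = ↧ₙ q
    rotate : ∀ a c e → a ℕ.* (c ℕ.* e) ≡ c ℕ.* (a ℕ.* e)
    rotate = ℕ-Solver.solve-∀

  Below-inhabited : ∃[ q ] Below q
  Below-inhabited = frac 0 v 0 , frac-below 0 v 0 (begin-strict
    X 0 1          ≡⟨ trans (ℕ.*-identityˡ (v ℕ.^ 1)) (ℕ.*-identityʳ v) ⟩
    v              <⟨ n<b^n b 1<b v ⟩
    b ℕ.^ v        ≤⟨ ℕ.m≤n*m (b ℕ.^ v) (u ℕ.^ 1) {{ℕ.m^n≢0 u 1 {{u≢0}}}} ⟩
    Y v 1          ∎)

  Above-inhabited : ∃[ q ] Above q
  Above-inhabited = frac u 0 0 , frac-above u 0 0 (begin-strict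
    Y 0 1          ≡⟨ trans (ℕ.*-identityʳ (u ℕ.^ 1)) (ℕ.*-identityʳ u) ⟩
    u              <⟨ n<b^n b 1<b u ⟩
    b ℕ.^ u        ≤⟨ ℕ.m≤m*n (b ℕ.^ u) (v ℕ.^ 1) {{ℕ.m^n≢0 v 1 {{v≢0}}}} ⟩
    X u 1          ∎)

numerator-nonZero : ∀ x .{{_ : Positive x}} → NonZero ℤ.∣ ↥ x ∣
numerator-nonZero (mkℚ (+ suc _) _ _) = _

log : (b : ℕ) .{{_ : NonTrivial b}} (x : ℚ) .{{_ : Positive x}} → ℝ
log b x = record
  { lower           = λ q → PowerBelow b q x
  ; upper           = λ q → PowerAbove b q x
  ; lower-inhabited = Below-inhabited
  ; upper-inhabited = Above-inhabited
  ; lower-closed    = λ {q} {r} → Below-closed {q} {r}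
  ; upper-closed    = λ {q} {r} → Above-closed {q} {r}
  ; lower-open      = λ {q} → Below-open {q}
  ; upper-open      = λ {q} → Above-open {q}
  ; disjoint        = λ (l , a) → ℕ.<-asym l a
  ; located         = λ {q} {r} → locate {q} {r}
  }
  where open Compare b (nonTrivial⇒n>1 b) ℤ.∣ ↥ x ∣ (↧ₙ x) (numerator-nonZero x) _

Sequence : Set₁
Sequence = (k : ℕ) .{{_ : NonTrivial k}} → ℝ

record ℚ⁺ : Set where
  field
    value          : ℚ
    {{isPositive}} : Positive value

-- Any positive real constants can be replaced by rational ones.

infix 4 _∈Θ_

_∈Θ_ : Sequence → Sequence → Set
f ∈Θ g = Σ[ c₁ ∈ ℚ⁺ ] Σ[ c₂ ∈ ℚ⁺ ] ∃[ K ]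
         (∀ k .{{_ : NonTrivial k}} → K ≤ k →
            value c₁ · g k ≤ᴿ f k × f k ≤ᴿ value c₂ · g k)
  where open ℚ⁺

ℕ→ℚ : ℕ → ℚ
ℕ→ℚ n = + n ℚ./ 1

-- log k / k; the base of the logarithm is immaterial up to Θ.

logk/k : Sequence
logk/k k = (+ 1 ℚ./ k) · log 2 (ℕ→ℚ k)
  where instance
    _ = nonTrivial⇒nonZero k
    _ = ℚ.normalize-pos 1 k
    _ = ℚ.normalize-pos k 1

bound : (k : ℕ) .{{_ : NonTrivial k}} → ℚ
bound k = (+ 2 ℚ./ 81) ℚ.* (+ (10 ^ k) ℚ./ (k ^ 2))
  where instance
    _ = nonTrivial⇒nonZero k
    _ = ℕ.m^n≢0 k 2

bound-positive : ∀ k .{{_ : NonTrivial k}} → Positive (bound k)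
bound-positive k = ℚ.pos*pos⇒pos (+ 2 ℚ./ 81) (+ (10 ^ k) ℚ./ (k ^ 2))
  where instance
    _ = nonTrivial⇒nonZero k
    _ = ℕ.m^n≢0 k 2
    _ = ℕ.m^n≢0 10 k
    _ = ℚ.normalize-pos (10 ^ k) (k ^ 2)

{-# OPTIONS --safe #-}
-- For a vertex set X, the number |X||V − X| of separated ordered pairs is bounded in terms of the number
-- of cut edges: in the Petersen graph by joining pairs by paths of length at most two, and in Cartesian
-- powers by changing one coordinate at a time.  Hence a set X containing between n/3 and 2n/3 of the
-- n = 10^k vertices cuts at least 20n/63 edges.  A matrix over 𝔽₂ with at most Δ ones in every row and
-- column has at most Δ² rk ones, because a basis of its row space meets every nonzero column; here Δ = 3k.
-- Every rank-decomposition has an edge with at least n/3 leaves on each side.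

module Submission where

open import Defs
open import Data.Nat.Base using (ℕ; _^_; NonTrivial)
open import Data.Product.Base using (Σ-syntax; _×_)
open import Data.Rational.Base using (_≤_)

open import Data.Bool.Base using (Bool; true; false; _∧_; _xor_; not)
import Data.Bool.Properties as Bool
open import Data.Fin.Base as Fin using (Fin; zero; suc; inject₁; fromℕ; _↑ˡ_; _↑ʳ_; combine; finToFun; remQuot)
open import Data.Fin.Properties as Fin using (_≟_; any?; all?; suc-injective; remQuot-combine; combine-remQuot; combine-surjective)
open import Data.Fin.Subset using (Subset; inside; outside; ⊥; ⁅_⁆; _∪_; ∁; ∣_∣; _∈_; _∉_; _⊆_)
open import Data.Fin.Subset.Properties
  using (_∈?_; ∉⊥; ∈⊤; ∣p∣≡n⇒p≡⊤; ∣p∣≤n; p⊂q⇒∣p∣<∣q∣; p⊆p∪q; q⊆p∪q; x∈p∪q⁻; x∈⁅x⁆; x∈⁅y⁆⇒x≡y; ∣∁p∣≡n∸∣p∣)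
open import Data.Integer.Base as ℤ using (ℤ)
import Data.Integer.Properties as ℤ
import Data.Integer.Tactic.RingSolver as ℤ-Solver
open import Data.List.Base as List using (List; []; _∷_; filter; length; allFin)
import Data.List.Membership.DecPropositional as DecMembership
open import Data.List.Membership.Propositional renaming (_∈_ to _∈ˡ_; _∉_ to _∉ˡ_) using ()
open import Data.List.Membership.Propositional.Properties
  using (∈-map⁺; ∈-filter⁺; ∈-++⁺ˡ; ∈-++⁺ʳ; ∈-lookup; ∈-cartesianProduct⁺; ∈-allFin)
open import Data.List.Relation.Unary.Any using (here; there)
open import Data.Nat.Base as ℕ using (zero; suc; _+_; _*_; z≤n; s≤s; NonZero; nonTrivial⇒nonZero; nonTrivial⇒n>1; n>1⇒nonTrivial)
import Data.Nat.Properties as ℕ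
import Data.Nat.Tactic.RingSolver as ℕ-Solver
open import Data.Product.Base using (∃-syntax; _,_; proj₁; proj₂; uncurry)
open import Data.Rational.Base as ℚ using (ℚ; mkℚ; ↥_; ↧_; ↧ₙ_; Positive; 1ℚ; ½; toℚᵘ)
import Data.Rational.Properties as ℚ
open import Data.Rational.Solver using (module +-*-Solver)
open import Data.Rational.Unnormalised.Base as ℚᵘ using (mkℚᵘ; *≡*)
import Data.Rational.Unnormalised.Properties as ℚᵘ
open import Data.Sum.Base as Sum using (_⊎_; inj₁; inj₂)
open import Data.Vec.Base as Vec using ([]; _∷_)
open import Data.Vec.Properties using (lookup-map; []=⇒lookup; lookup⇒[]=; lookup∘tabulate)
open import Function.Base using (_∘_; id)
open import Function.Bundles using (module Bijection)
open import Level using (0ℓ)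
open import Relation.Binary.Construct.Closure.ReflexiveTransitive as Star using (Star; ε; _◅_; _◅◅_)
open import Relation.Binary.Definitions using (tri<; tri≈; tri>)
open import Relation.Binary.PropositionalEquality
  using (_≡_; _≢_; refl; sym; trans; cong; cong₂; subst; subst₂; module ≡-Reasoning)
open import Relation.Nullary.Decidable
  using (Dec; yes; no; does; dec-true; dec-false; from-yes; _×-dec_; _⊎-dec_; ¬?; decidable-stable)
open import Relation.Nullary.Negation using (¬_; contradiction)
open import Relation.Unary using (Pred; Decidable)

open import Algebra.Properties.Semiring.Sum ℕ.+-*-semiring
  using (sum; sum-cong-≗; ∑-distrib-+; ∑-comm; *-distribˡ-sum; *-distribʳ-sum)
open Graph using (~-sym; ~-irr)

-- Isoperimetry of Cartesian powers

-- The isoperimetric constant does not decay with `k`. Splitting off a coordinate bounds the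
-- separated pairs, and decomposes the cut edges, by sums over the fibres of the product; after
-- normalisation both kinds of fibre carry the constant 7 that the Petersen graph has by itself.
-- Beyond the order of the graph, `k` therefore enters only through the squared maximum degree 9k²
-- in the rank estimate. The constants: a balanced cut separates at least (2/9)n² pairs, and 10 ·
-- (2/9)n² ≤ 7n · cut gives the 20n/63; dividing by 9k² leaves 20n/(567k²), while the stated
-- 2n/(81k²) is 14n/(567k²).
--
-- The equality with n^(1 - Θ(log k / k)) concerns only the explicit bound. Its exponent is exactly
-- 1 - log_n(81k²/2), so the Θ-claim compares logarithms to different bases. Since real numbers are
-- Dedekind cuts and membership in a cut of a logarithm is an inequality between powers of natural
-- numbers, the comparison is made rational by rational on integer powers, with separate cases for
-- the sign of the rational.

sum-mono : ∀ {n} {f g : Fin n → ℕ} → (∀ i → f i ℕ.≤ g i) → sum f ℕ.≤ sum g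
sum-mono {zero}  f≤g = z≤n
sum-mono {suc n} f≤g = ℕ.+-mono-≤ (f≤g zero) (sum-mono (f≤g ∘ suc))

sum-const : ∀ n c → sum {n} (λ _ → c) ≡ n * c
sum-const zero    c = refl
sum-const (suc n) c = cong (c +_) (sum-const n c)

term≤sum : ∀ {n} (f : Fin n → ℕ) i → f i ℕ.≤ sum f
term≤sum f zero    = ℕ.m≤m+n _ _
term≤sum f (suc i) = ℕ.≤-trans (term≤sum (f ∘ suc) i) (ℕ.m≤n+m _ _)

sum-cong₂ : ∀ {m n} {f g : Fin m → Fin n → ℕ} → (∀ i j → f i j ≡ g i j) →
            (sum λ i → sum λ j → f i j) ≡ (sum λ i → sum λ j → g i j)
sum-cong₂ f≡g = sum-cong-≗ λ i → sum-cong-≗ (f≡g i)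

sum-mono₂ : ∀ {m n} {f g : Fin m → Fin n → ℕ} → (∀ i j → f i j ℕ.≤ g i j) →
            (sum λ i → sum λ j → f i j) ℕ.≤ (sum λ i → sum λ j → g i j)
sum-mono₂ f≤g = sum-mono λ i → sum-mono (f≤g i)

∑-distrib-+₂ : ∀ {m n} (f g : Fin m → Fin n → ℕ) →
               (sum λ i → sum λ j → f i j + g i j) ≡ (sum λ i → sum λ j → f i j) + (sum λ i → sum λ j → g i j)
∑-distrib-+₂ f g = trans (sum-cong-≗ λ i → ∑-distrib-+ (f i) (g i)) (∑-distrib-+ (λ i → sum (f i)) (λ i → sum (g i)))

sum-++ : ∀ m {n} (f : Fin (m + n) → ℕ) → sum f ≡ sum (λ i → f (i ↑ˡ n)) + sum (λ j → f (m ↑ʳ j))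
sum-++ zero    f = refl
sum-++ (suc m) f = trans (cong (f zero +_) (sum-++ m (f ∘ suc))) (sym (ℕ.+-assoc (f zero) _ _))

sum-combine : ∀ m {n} (f : Fin (m * n) → ℕ) → sum f ≡ sum λ (a : Fin m) → sum λ (b : Fin n) → f (combine a b)
sum-combine zero        f = refl
sum-combine (suc m) {n} f = trans (sum-++ n f) (cong (sum (λ j → f (j ↑ˡ (m * n))) +_) (sum-combine m (f ∘ (n ↑ʳ_))))

𝟙 : Bool → ℕ
𝟙 true  = 1
𝟙 false = 0

𝟙-does-yes : ∀ {P : Set} (P? : Dec P) → P → 𝟙 (does P?) ≡ 1
𝟙-does-yes P? p = cong 𝟙 (dec-true P? p)

𝟙-does-no : ∀ {P : Set} (P? : Dec P) → ¬ P → 𝟙 (does P?) ≡ 0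
𝟙-does-no P? ¬p = cong 𝟙 (dec-false P? ¬p)

𝟙-does-⇔ : ∀ {P Q : Set} (P? : Dec P) (Q? : Dec Q) → (P → Q) → (Q → P) → 𝟙 (does P?) ≡ 𝟙 (does Q?)
𝟙-does-⇔ (yes p) Q? p⇒q q⇒p = sym (𝟙-does-yes Q? (p⇒q p))
𝟙-does-⇔ (no ¬p) Q? p⇒q q⇒p = sym (𝟙-does-no Q? (¬p ∘ q⇒p))

sum-δ : ∀ {n} (i : Fin n) (f : Fin n → ℕ) → (sum λ j → 𝟙 (does (i ≟ j)) * f j) ≡ f i
sum-δ {suc n} zero f = begin
  f zero + 0 + sum {n} (λ _ → 0)  ≡⟨ cong₂ _+_ (ℕ.+-identityʳ _) (trans (sum-const n 0) (ℕ.*-zeroʳ n)) ⟩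
  f zero + 0                      ≡⟨ ℕ.+-identityʳ _ ⟩
  f zero                          ∎
  where open ≡-Reasoning
sum-δ {suc n} (suc i) f = trans
  (sum-cong-≗ λ j → cong (_* f (suc j)) (𝟙-does-⇔ (suc i ≟ suc j) (i ≟ j) suc-injective (cong suc)))
  (sum-δ i (f ∘ suc))

adj : ∀ {n} → Graph n → Fin n → Fin n → ℕ
adj G x y = 𝟙 (does (x ~? y))
  where open Graph G using (_~_; _~?_)

adj-sym : ∀ {n} (G : Graph n) x y → adj G x y ≡ adj G y x
adj-sym G x y = 𝟙-does-⇔ (x ~? y) (y ~? x) (~-sym G) (~-sym G)
  where open Graph G using (_~_; _~?_)

-- Directed from inside to outside, so that a double sum over all ordered pairs counts each
-- separated pair, and each cut edge, exactly once.
sep : ∀ {n} → (Fin n → Bool) → Fin n → Fin n → ℕ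
sep f x y = 𝟙 (f x ∧ not (f y))

sep-refl : ∀ {n} (f : Fin n → Bool) x → sep f x x ≡ 0
sep-refl f x with f x
... | true  = refl
... | false = refl

-- If y is inside, the step from y to z leaves the set; if y is outside, the step from x to y
-- already does.
sep-triangle : ∀ {n} (f : Fin n → Bool) x y z → sep f x z ℕ.≤ sep f x y + sep f y z
sep-triangle f x y z with f x | f y | f z
... | false | _     | _     = z≤n
... | true  | true  | c     = ℕ.≤-refl
... | true  | false | true  = z≤n
... | true  | false | false = s≤s z≤n

pairs : ∀ {n} → (Fin n → Bool) → ℕ
pairs f = sum λ x → sum λ y → sep f x y

cut : ∀ {n} → Graph n → (Fin n → Bool) → ℕ
cut G f = sum λ x → sum λ y → adj G x y * sep f x y

MaxDegree : ∀ {n} → Graph n → ℕ → Set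
MaxDegree G d = ∀ x → sum (adj G x) ℕ.≤ d

DiameterTwo : ∀ {n} → Graph n → Set
DiameterTwo {n} G = ∀ x y → x ≡ y ⊎ x ~ y ⊎ ∃[ z ] x ~ z × z ~ y
  where open Graph G using (_~_; _~?_)

module _ {n} (G : Graph n) {d} (deg≤d : MaxDegree G d) (diam : DiameterTwo G) (f : Fin n → Bool) where
  open Graph G using (_~_; _~?_)
  private
    A : Fin n → Fin n → ℕ
    A = adj G
    S : Fin n → Fin n → ℕ
    S = sep f

    -- All middle vertices z are summed over, although a single one would do: no path has to be
    -- chosen, and the double counting in `first` and `second` becomes a plain exchange of sums.
    short : ∀ x y → S x y ℕ.≤ A x y * S x y + ((sum λ z → A x z * S x z * A z y) + (sum λ z → A x z * (A z y * S z y)))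
    short x y with diam x y
    ... | inj₁ refl = ℕ.≤-trans (ℕ.≤-reflexive (sep-refl f x)) z≤n
    ... | inj₂ (inj₁ x~y) = ℕ.≤-trans
      (ℕ.≤-reflexive (sym (trans (cong (_* S x y) (𝟙-does-yes (x ~? y) x~y)) (ℕ.+-identityʳ _)))) (ℕ.m≤m+n _ _)
    ... | inj₂ (inj₂ (z , x~z , z~y)) = begin
      S x y                                        ≤⟨ sep-triangle f x z y ⟩
      S x z + S z y                                ≡⟨ cong₂ _+_ (ring (S x z)) (ring′ (S z y)) ⟨
      1 * S x z * 1 + 1 * (1 * S z y)              ≡⟨ cong₂ (λ a b → a * S x z * b + a * (b * S z y)) (𝟙-does-yes (x ~? z) x~z) (𝟙-does-yes (z ~? y) z~y) ⟨
      A x z * S x z * A z y + A x z * (A z y * S z y)  ≤⟨ ℕ.+-mono-≤ (term≤sum (λ z → A x z * S x z * A z y) z) (term≤sum (λ z → A x z * (A z y * S z y)) z) ⟩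
      _                                            ≤⟨ ℕ.m≤n+m _ (A x y * S x y) ⟩
      _ ∎
      where
      open ℕ.≤-Reasoning
      ring : ∀ a → 1 * a * 1 ≡ a
      ring = ℕ-Solver.solve-∀
      ring′ : ∀ a → 1 * (1 * a) ≡ a
      ring′ = ℕ-Solver.solve-∀

    first : (sum λ x → sum λ y → sum λ z → A x z * S x z * A z y) ℕ.≤ d * cut G f
    first = begin
      (sum λ x → sum λ y → sum λ z → A x z * S x z * A z y)  ≡⟨ sum-cong-≗ (λ x → ∑-comm (λ y z → A x z * S x z * A z y)) ⟩
      (sum λ x → sum λ z → sum λ y → A x z * S x z * A z y)  ≡⟨ sum-cong₂ (λ x z → *-distribˡ-sum (A x z * S x z) (A z)) ⟨
      (sum λ x → sum λ z → A x z * S x z * sum (A z))        ≤⟨ sum-mono₂ (λ x z → ℕ.*-monoʳ-≤ (A x z * S x z) (deg≤d z)) ⟩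
      (sum λ x → sum λ z → A x z * S x z * d)                ≡⟨ sum-cong-≗ (λ x → *-distribʳ-sum d (λ z → A x z * S x z)) ⟨
      (sum λ x → (sum λ z → A x z * S x z) * d)              ≡⟨ *-distribʳ-sum d (λ x → sum λ z → A x z * S x z) ⟨
      cut G f * d                                            ≡⟨ ℕ.*-comm (cut G f) d ⟩
      d * cut G f                                            ∎
      where open ℕ.≤-Reasoning

    second : (sum λ x → sum λ y → sum λ z → A x z * (A z y * S z y)) ℕ.≤ d * cut G f
    second = begin
      (sum λ x → sum λ y → sum λ z → A x z * (A z y * S z y))  ≡⟨ sum-cong-≗ (λ x → ∑-comm (λ y z → A x z * (A z y * S z y))) ⟩
      (sum λ x → sum λ z → sum λ y → A x z * (A z y * S z y))  ≡⟨ sum-cong₂ (λ x z → *-distribˡ-sum (A x z) (λ y → A z y * S z y)) ⟨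
      (sum λ x → sum λ z → A x z * sum λ y → A z y * S z y)    ≡⟨ ∑-comm (λ x z → A x z * sum λ y → A z y * S z y) ⟩
      (sum λ z → sum λ x → A x z * sum λ y → A z y * S z y)    ≡⟨ sum-cong-≗ (λ z → *-distribʳ-sum (sum λ y → A z y * S z y) (λ x → A x z)) ⟨
      (sum λ z → (sum λ x → A x z) * sum λ y → A z y * S z y)  ≡⟨ sum-cong-≗ (λ z → cong (_* sum λ y → A z y * S z y) (sum-cong-≗ λ x → adj-sym G x z)) ⟩
      (sum λ z → sum (A z) * sum λ y → A z y * S z y)          ≤⟨ sum-mono (λ z → ℕ.*-monoˡ-≤ (sum λ y → A z y * S z y) (deg≤d z)) ⟩
      (sum λ z → d * sum λ y → A z y * S z y)                  ≡⟨ *-distribˡ-sum d (λ z → sum λ y → A z y * S z y) ⟨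
      d * cut G f                                              ∎
      where open ℕ.≤-Reasoning

  -- A pair of vertices is joined by a path of length at most two, and an edge occurs at most d times as
  -- the first and at most d times as the second step of such a path.
  pairs≤cut : pairs f ℕ.≤ (1 + 2 * d) * cut G f
  pairs≤cut = begin
    pairs f                            ≤⟨ sum-mono₂ short ⟩
    (sum λ x → sum λ y → A x y * S x y + (P x y + Q x y))  ≡⟨ ∑-distrib-+₂ (λ x y → A x y * S x y) (λ x y → P x y + Q x y) ⟩
    cut G f + (sum λ x → sum λ y → P x y + Q x y)          ≡⟨ cong (cut G f +_) (∑-distrib-+₂ P Q) ⟩
    _                                  ≤⟨ ℕ.+-monoʳ-≤ (cut G f) (ℕ.+-mono-≤ first second) ⟩
    cut G f + (d * cut G f + d * cut G f) ≡⟨ ring (cut G f) d ⟩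
    (1 + 2 * d) * cut G f              ∎
    where
    open ℕ.≤-Reasoning
    P Q : Fin n → Fin n → ℕ
    P x y = sum λ z → A x z * S x z * A z y
    Q x y = sum λ z → A x z * (A z y * S z y)
    ring : ∀ c d → c + (d * c + d * c) ≡ (1 + 2 * d) * c
    ring = ℕ-Solver.solve-∀

-- This and the diameter are settled by evaluation on the ten vertices of the graph as defined,
-- without fixing a labelling of them by edges of K₅.
petersen-degree : MaxDegree petersen 3
petersen-degree = from-yes (all? λ x → sum (adj petersen x) ℕ.≤? 3)

petersen-diameter : DiameterTwo petersen
petersen-diameter = from-yes (all? λ x → all? λ y → (x ≟ y) ⊎-dec (x ~? y) ⊎-dec any? λ z → (x ~? z) ×-dec (z ~? y))
  where open Graph petersen using (_~?_)

finToFun-injective : ∀ {n} k {x y : Fin (n ^ k)} → (∀ i → finToFun {n} {k} x i ≡ finToFun {n} {k} y i) → x ≡ y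
finToFun-injective zero    {zero} {zero} _ = refl
finToFun-injective {n} (suc k) {x} {y} x≗y = begin
  x                                 ≡⟨ combine-remQuot {n} (n ^ k) x ⟨
  uncurry combine (remQuot {n} (n ^ k) x)  ≡⟨ cong₂ combine (x≗y zero) (finToFun-injective k (x≗y ∘ suc)) ⟩
  uncurry combine (remQuot {n} (n ^ k) y)  ≡⟨ combine-remQuot {n} (n ^ k) y ⟩
  y                                 ∎
  where open ≡-Reasoning

module _ {n} (G : Graph n) (k : ℕ) where
  open Graph G using (_~_; _~?_)
  open Graph (G □^ k) using () renaming (_~_ to _~ᵏ_; _~?_ to _~ᵏ?_)
  open Graph (G □^ suc k) using () renaming (_~_ to _~ᵏ⁺¹_; _~?_ to _~ᵏ⁺¹?_)

  private
    head-≡ : ∀ a b → finToFun {n} {suc k} (combine a b) zero ≡ a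
    head-≡ a b = cong proj₁ (remQuot-combine a b)

    tail-≡ : ∀ (a : Fin n) b i → finToFun {n} {suc k} (combine a b) (suc i) ≡ finToFun b i
    tail-≡ a b i = cong (λ ab → finToFun (proj₂ ab) i) (remQuot-combine a b)

    -- Adjacency in the binary Cartesian product of `G` and `G □^ k`. Identifying it with adjacency
    -- in `G □^ suc k`, by `split` and `join`, opens the powers to induction on `k`.
    Step : (a a′ : Fin n) (b b′ : Fin (n ^ k)) → Set
    Step a a′ b b′ = (b ≡ b′ × a ~ a′) ⊎ (a ≡ a′ × b ~ᵏ b′)

    split : ∀ a a′ b b′ → combine a b ~ᵏ⁺¹ combine a′ b′ → Step a a′ b b′
    split a a′ b b′ (zero , x~y , same) = inj₁
      ( finToFun-injective k (λ j → subst₂ _≡_ (tail-≡ a b j) (tail-≡ a′ b′ j) (same (suc j) λ ()))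
      , subst₂ _~_ (head-≡ a b) (head-≡ a′ b′) x~y )
    split a a′ b b′ (suc i , x~y , same) = inj₂
      ( subst₂ _≡_ (head-≡ a b) (head-≡ a′ b′) (same zero λ ())
      , i , subst₂ _~_ (tail-≡ a b i) (tail-≡ a′ b′ i) x~y
      , λ j j≢i → subst₂ _≡_ (tail-≡ a b j) (tail-≡ a′ b′ j) (same (suc j) (j≢i ∘ suc-injective)) )

    join : ∀ a a′ b b′ → Step a a′ b b′ → combine a b ~ᵏ⁺¹ combine a′ b′
    join a a′ b .b (inj₁ (refl , a~a′)) = zero , subst₂ _~_ (sym (head-≡ a b)) (sym (head-≡ a′ b)) a~a′ , λ
      { zero    0≢0 → contradiction refl 0≢0
      ; (suc j) _   → trans (tail-≡ a b j) (sym (tail-≡ a′ b j)) }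
    join a .a b b′ (inj₂ (refl , i , b~b′ , same)) =
      suc i , subst₂ _~_ (sym (tail-≡ a b i)) (sym (tail-≡ a b′ i)) b~b′ , λ
      { zero    _   → trans (head-≡ a b) (sym (head-≡ a b′))
      ; (suc j) j≢i → trans (tail-≡ a b j) (trans (same j (j≢i ∘ cong suc)) (sym (tail-≡ a b′ j))) }

    step? : ∀ a a′ b b′ → Dec (Step a a′ b b′)
    step? a a′ b b′ = ((b ≟ b′) ×-dec (a ~? a′)) ⊎-dec ((a ≟ a′) ×-dec (b ~ᵏ? b′))

    𝟙-step : ∀ a a′ b b′ → 𝟙 (does (step? a a′ b b′)) ≡
             𝟙 (does (b ≟ b′)) * adj G a a′ + 𝟙 (does (a ≟ a′)) * adj (G □^ k) b b′
    𝟙-step a a′ b b′ with b ≟ b′ | a ~? a′ | a ≟ a′ | b ~ᵏ? b′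
    -- Irreflexivity makes the two kinds of step exclude each other, so the indicator of the
    -- disjunction is the sum of the indicators.
    ... | yes _ | yes a~a | yes refl | _     = contradiction a~a (~-irr G)
    ... | yes _ | yes _   | no _     | _     = refl
    ... | yes _ | no _    | yes _    | yes _ = refl
    ... | yes _ | no _    | yes _    | no _  = refl
    ... | yes _ | no _    | no _     | _     = refl
    ... | no _  | _       | yes _    | yes _ = refl
    ... | no _  | _       | yes _    | no _  = refl
    ... | no _  | _       | no _     | _     = refl

  adj-suc : ∀ a a′ b b′ → adj (G □^ suc k) (combine a b) (combine a′ b′) ≡
            𝟙 (does (b ≟ b′)) * adj G a a′ + 𝟙 (does (a ≟ a′)) * adj (G □^ k) b b′
  adj-suc a a′ b b′ = trans
    (𝟙-does-⇔ (combine a b ~ᵏ⁺¹? combine a′ b′) (step? a a′ b b′) (split a a′ b b′) (join a a′ b b′))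
    (𝟙-step a a′ b b′)

  -- The weight `g` serves two uses: `sep f` from a fixed vertex splits a cut, the constant 1 splits
  -- a degree.
  sum-adj-suc : ∀ a b (g : Fin (n ^ suc k) → ℕ) →
    (sum λ y → adj (G □^ suc k) (combine a b) y * g y) ≡
    (sum λ a′ → adj G a a′ * g (combine a′ b)) + (sum λ b′ → adj (G □^ k) b b′ * g (combine a b′))
  sum-adj-suc a b g = begin
    (sum λ y → adj (G □^ suc k) (c a b) y * g y)
      ≡⟨ sum-combine n {n ^ k} (λ y → adj (G □^ suc k) (c a b) y * g y) ⟩
    (sum λ a′ → sum λ b′ → adj (G □^ suc k) (c a b) (c a′ b′) * g (c a′ b′))
      ≡⟨ sum-cong₂ (λ a′ b′ → trans (cong (_* g (c a′ b′)) (adj-suc a a′ b b′))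
           (ring (δ b b′) (adj G a a′) (δ a a′) (adj (G □^ k) b b′) (g (c a′ b′)))) ⟩
    (sum λ a′ → sum λ b′ → δ b b′ * (adj G a a′ * g (c a′ b′)) + δ a a′ * (adj (G □^ k) b b′ * g (c a′ b′)))
      ≡⟨ ∑-distrib-+₂ (λ a′ b′ → δ b b′ * (adj G a a′ * g (c a′ b′))) (λ a′ b′ → δ a a′ * (adj (G □^ k) b b′ * g (c a′ b′))) ⟩
    (sum λ a′ → sum λ b′ → δ b b′ * (adj G a a′ * g (c a′ b′))) + (sum λ a′ → sum λ b′ → δ a a′ * (adj (G □^ k) b b′ * g (c a′ b′)))
      ≡⟨ cong₂ _+_ (sum-cong-≗ λ a′ → sum-δ b (λ b′ → adj G a a′ * g (c a′ b′)))
           (trans (∑-comm (λ a′ b′ → δ a a′ * (adj (G □^ k) b b′ * g (c a′ b′))))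
                  (sum-cong-≗ λ b′ → sum-δ a (λ a′ → adj (G □^ k) b b′ * g (c a′ b′)))) ⟩
    _ ∎
    where
    open ≡-Reasoning
    c : Fin n → Fin (n ^ k) → Fin (n ^ suc k)
    c = combine
    δ : ∀ {m} → Fin m → Fin m → ℕ
    δ i j = 𝟙 (does (i ≟ j))
    ring : ∀ p q r s t → (p * q + r * s) * t ≡ p * (q * t) + r * (s * t)
    ring = ℕ-Solver.solve-∀

  -- Every edge of the product lies in exactly one fibre: a copy of `G` over some `b`, or a copy of
  -- `G □^ k` over some `a`.
  cut-suc : ∀ f → cut (G □^ suc k) f ≡
            (sum λ (b : Fin (n ^ k)) → cut G (λ a → f (combine a b))) + (sum λ (a : Fin n) → cut (G □^ k) (λ b → f (combine a b)))
  cut-suc f = begin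
    cut (G □^ suc k) f
      ≡⟨ sum-combine n {n ^ k} _ ⟩
    (sum λ a → sum λ b → sum λ y → adj (G □^ suc k) (c a b) y * sep f (c a b) y)
      ≡⟨ sum-cong₂ (λ a b → sum-adj-suc a b (sep f (c a b))) ⟩
    (sum λ a → sum λ b → P a b + Q a b)
      ≡⟨ ∑-distrib-+₂ P Q ⟩
    (sum λ a → sum λ b → P a b) + (sum λ a → sum λ b → Q a b)
      ≡⟨ cong (_+ (sum λ a → sum λ b → Q a b)) (∑-comm P) ⟩
    (sum λ b → sum λ a → P a b) + (sum λ a → sum λ b → Q a b) ∎
    where
    open ≡-Reasoning
    c : Fin n → Fin (n ^ k) → Fin (n ^ suc k)
    c = combine
    P Q : Fin n → Fin (n ^ k) → ℕ
    P a b = sum λ a′ → adj G a a′ * sep f (c a b) (c a′ b)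
    Q a b = sum λ b′ → adj (G □^ k) b b′ * sep f (c a b) (c a b′)

-- Between (a, b) and (a′, b′) the vertex (a′, b) is inserted. The first step does not depend on b′
-- and the second not on a, whence the factors `N` and `n`.
pairs-combine : ∀ n N (f : Fin (n * N) → Bool) → pairs f ℕ.≤
  N * (sum λ (b : Fin N) → pairs {n} λ a → f (combine a b)) + n * (sum λ (a : Fin n) → pairs {N} λ b → f (combine a b))
pairs-combine n N f = begin
  pairs f
    ≡⟨ sum-combine n {N} _ ⟩
  (sum λ (a : Fin n) → sum λ (b : Fin N) → sum (sep f (c a b)))
    ≡⟨ sum-cong₂ (λ a b → sum-combine n {N} (sep f (c a b))) ⟩
  (sum λ a → sum λ b → sum λ (a′ : Fin n) → sum λ (b′ : Fin N) → sep f (c a b) (c a′ b′))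
    ≤⟨ sum-mono₂ (λ a b → sum-mono₂ λ a′ b′ → sep-triangle f (c a b) (c a′ b) (c a′ b′)) ⟩
  (sum λ a → sum λ b → sum λ a′ → sum λ b′ → P b a a′ + Q a′ b b′)
    ≡⟨ sum-cong₂ (λ a b → trans (∑-distrib-+₂ (λ a′ b′ → P b a a′) (λ a′ b′ → Q a′ b b′))
         (cong (_+ (sum λ a′ → sum (Q a′ b))) (sum-cong-≗ λ a′ → sum-const N (P b a a′)))) ⟩
  (sum λ a → sum λ b → (sum λ a′ → N * P b a a′) + (sum λ a′ → sum (Q a′ b)))
    ≡⟨ ∑-distrib-+₂ (λ a b → sum λ a′ → N * P b a a′) (λ a b → sum λ a′ → sum (Q a′ b)) ⟩
  (sum λ a → sum λ b → sum λ a′ → N * P b a a′) + (sum {n} λ a → sum λ b → sum λ a′ → sum (Q a′ b))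
    ≡⟨ cong₂ _+_ (sum-cong₂ λ a b → sym (*-distribˡ-sum N (P b a))) (sum-const n _) ⟩
  (sum λ a → sum λ b → N * sum (P b a)) + n * (sum λ b → sum λ a′ → sum (Q a′ b))
    ≡⟨ cong₂ _+_ (∑-comm (λ a b → N * sum (P b a))) (cong (n *_) (∑-comm (λ b a′ → sum (Q a′ b)))) ⟩
  (sum λ b → sum λ a → N * sum (P b a)) + n * (sum λ a′ → sum λ b → sum (Q a′ b))
    ≡⟨ cong (_+ n * (sum λ a′ → sum λ b → sum (Q a′ b))) (trans (sum-cong-≗ λ b → sym (*-distribˡ-sum N (λ a → sum (P b a))))
         (sym (*-distribˡ-sum N (λ b → sum λ a → sum (P b a))))) ⟩
  N * (sum λ b → sum λ a → sum (P b a)) + n * (sum λ a′ → sum λ b → sum (Q a′ b)) ∎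
  where
  open ℕ.≤-Reasoning
  c : Fin n → Fin N → Fin (n * N)
  c = combine
  P : Fin N → Fin n → Fin n → ℕ
  P b a a′ = sep f (c a b) (c a′ b)
  Q : Fin n → Fin N → Fin N → ℕ
  Q a b b′ = sep f (c a b) (c a b′)

-- Moving through the coordinates one at a time, as in the Efron–Stein inequality.
pairs≤cut-□^ : ∀ {n} (G : Graph n) C → (∀ f → pairs f ℕ.≤ C * cut G f) →
               ∀ k f → n * pairs f ℕ.≤ C * n ^ k * cut (G □^ k) f
pairs≤cut-□^ {n} G C h zero    f = ℕ.≤-trans
  (ℕ.≤-reflexive (trans (cong (λ s → n * (s + 0 + 0)) (sep-refl f zero)) (ℕ.*-zeroʳ n))) z≤n
pairs≤cut-□^ {n} G C h (suc k) f = begin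
  n * pairs f
    ≤⟨ ℕ.*-monoʳ-≤ n (pairs-combine n N f) ⟩
  n * (N * (sum λ b → pairs (col b)) + n * (sum λ a → pairs (row a)))
    ≡⟨ cong (λ s → n * (N * (sum λ b → pairs (col b)) + s)) (*-distribˡ-sum n (λ a → pairs (row a))) ⟩
  n * (N * (sum λ b → pairs (col b)) + (sum λ a → n * pairs (row a)))
    ≤⟨ ℕ.*-monoʳ-≤ n (ℕ.+-mono-≤ (ℕ.*-monoʳ-≤ N (sum-mono λ b → h (col b)))
         (sum-mono λ a → pairs≤cut-□^ G C h k (row a))) ⟩
  n * (N * (sum λ b → C * cut G (col b)) + (sum λ a → C * N * cut (G □^ k) (row a)))
    ≡⟨ cong (n *_) (cong₂ _+_ (cong (N *_) (*-distribˡ-sum C λ b → cut G (col b)))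
         (*-distribˡ-sum (C * N) λ a → cut (G □^ k) (row a))) ⟨
  -- Both kinds of fibre end with the same factor `C * (n * N)`. The `n` in front of `pairs f` is
  -- there for this, and it is why `C` survives the induction unchanged.
  n * (N * (C * X) + C * N * Y)
    ≡⟨ ring n N C X Y ⟩
  C * (n * N) * (X + Y)
    ≡⟨ cong (C * (n * N) *_) (cut-suc G k f) ⟨
  C * (n * N) * cut (G □^ suc k) f ∎
  where
  open ℕ.≤-Reasoning
  N = n ^ k
  col : Fin N → Fin n → Bool
  col b a = f (combine a b)
  row : Fin n → Fin N → Bool
  row a b = f (combine a b)
  X = sum λ b → cut G (col b)
  Y = sum λ a → cut (G □^ k) (row a)
  ring : ∀ n N C X Y → n * (N * (C * X) + C * N * Y) ≡ C * (n * N) * (X + Y)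
  ring = ℕ-Solver.solve-∀

degree-□^ : ∀ {n} (G : Graph n) {d} → MaxDegree G d → ∀ k → MaxDegree (G □^ k) (k * d)
degree-□^ G deg≤d zero    zero = z≤n
degree-□^ {n} G {d} deg≤d (suc k) x with combine-surjective {n} {n ^ k} x
... | a , b , refl = begin
  sum (adj (G □^ suc k) (combine a b))
    ≡⟨ sum-cong-≗ (λ y → ℕ.*-identityʳ (adj (G □^ suc k) (combine a b) y)) ⟨
  (sum λ y → adj (G □^ suc k) (combine a b) y * 1)
    ≡⟨ sum-adj-suc G k a b (λ _ → 1) ⟩
  (sum λ a′ → adj G a a′ * 1) + (sum λ b′ → adj (G □^ k) b b′ * 1)
    ≡⟨ cong₂ _+_ (sum-cong-≗ λ a′ → ℕ.*-identityʳ (adj G a a′)) (sum-cong-≗ λ b′ → ℕ.*-identityʳ (adj (G □^ k) b b′)) ⟩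
  sum (adj G a) + sum (adj (G □^ k) b)
    ≤⟨ ℕ.+-mono-≤ (deg≤d a) (degree-□^ G deg≤d k b) ⟩
  d + k * d ∎
  where open ℕ.≤-Reasoning

-- Cut-rank

𝟙-∧ : ∀ a b → 𝟙 (a ∧ b) ≡ 𝟙 a * 𝟙 b
𝟙-∧ true  b = sym (ℕ.+-identityʳ (𝟙 b))
𝟙-∧ false b = refl

𝟙≤1 : ∀ a → 𝟙 a ℕ.≤ 1
𝟙≤1 true  = s≤s z≤n
𝟙≤1 false = z≤n

𝟙*n≤n : ∀ a n → 𝟙 a * n ℕ.≤ n
𝟙*n≤n a n = ℕ.≤-trans (ℕ.*-monoˡ-≤ n (𝟙≤1 a)) (ℕ.≤-reflexive (ℕ.*-identityˡ n))

∣∣≡sum : ∀ {n} (S : Subset n) → ∣ S ∣ ≡ sum (𝟙 ∘ Vec.lookup S)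
∣∣≡sum []            = refl
∣∣≡sum (inside  ∷ S) = cong suc (∣∣≡sum S)
∣∣≡sum (outside ∷ S) = ∣∣≡sum S

∣tabulate∣≡sum : ∀ {n} (f : Fin n → Bool) → ∣ Vec.tabulate f ∣ ≡ sum (𝟙 ∘ f)
∣tabulate∣≡sum f = trans (∣∣≡sum (Vec.tabulate f)) (sum-cong-≗ λ i → cong 𝟙 (lookup∘tabulate f i))

does-∈? : ∀ {n} (x : Fin n) S → does (x ∈? S) ≡ Vec.lookup S x
does-∈? x S with Vec.lookup S x in eq
... | true  = dec-true (x ∈? S) (lookup⇒[]= x S eq)
... | false = dec-false (x ∈? S) λ x∈S → contradiction (trans (sym eq) ([]=⇒lookup x∈S)) λ ()

∈⇒≤maximum : ∀ {x xs} → x ∈ˡ xs → x ℕ.≤ maximum xs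
∈⇒≤maximum {xs = y ∷ ys} (here refl)  = ℕ.m≤m⊔n y (maximum ys)
∈⇒≤maximum {xs = y ∷ ys} (there x∈ys) = ℕ.≤-trans (∈⇒≤maximum x∈ys) (ℕ.m≤n⊔m y (maximum ys))

∈-subsets : ∀ {n} (S : Subset n) → S ∈ˡ subsets n
∈-subsets []            = here refl
∈-subsets (outside ∷ S) = ∈-++⁺ˡ (∈-map⁺ (outside ∷_) (∈-subsets S))
∈-subsets (inside  ∷ S) = ∈-++⁺ʳ _ (∈-map⁺ (inside ∷_) (∈-subsets S))

∑₂-zero : ∀ {n} {f : Fin n → Bool} → (∀ s → f s ≡ false) → ∑₂ f ≡ false
∑₂-zero {zero}  _   = refl
∑₂-zero {suc n} f≡0 rewrite f≡0 zero = ∑₂-zero (f≡0 ∘ suc)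

∑₂-single : ∀ {n} (i : Fin n) {f : Fin n → Bool} → (∀ s → s ≢ i → f s ≡ false) → ∑₂ f ≡ f i
∑₂-single zero    {f} h = trans (cong (f zero xor_) (∑₂-zero λ s → h (suc s) λ ())) (Bool.xor-identityʳ (f zero))
∑₂-single (suc i) {f} h rewrite h zero (λ ()) = ∑₂-single i λ s s≢i → h (suc s) (s≢i ∘ suc-injective)

module _ {p q} (M : Matrix₂ p q) where

  Independent : Subset p → Set
  Independent S = ¬ DependentRows M S

  Maximal : Subset p → Set
  Maximal S = ∀ i → i ∉ S → DependentRows M (S ∪ ⁅ i ⁆)

  independent≤rank : ∀ {S} → Independent S → ∣ S ∣ ℕ.≤ rank₂ M
  independent≤rank {S} ind = ∈⇒≤maximum (∈-map⁺ ∣_∣ (∈-filter⁺ (λ S → ¬? (dependentRows? M S)) (∈-subsets S) ind))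

  private
    -- The fuel bounds the number of rows still outside `S`. When it runs out, `S` contains every
    -- row and is maximal vacuously.
    grow : ∀ fuel S → p ℕ.≤ ∣ S ∣ + fuel → Independent S → ∃[ T ] Independent T × Maximal T
    grow zero S p≤∣S∣ ind = S , ind , λ i i∉S → contradiction
      (subst (i ∈_) (sym (∣p∣≡n⇒p≡⊤ (ℕ.≤-antisym (∣p∣≤n S) (subst (p ℕ.≤_) (ℕ.+-identityʳ _) p≤∣S∣)))) ∈⊤) i∉S
    grow (suc fuel) S p≤ ind
      with any? (λ i → ¬? (i ∈? S) ×-dec ¬? (dependentRows? M (S ∪ ⁅ i ⁆)))
    ... | no  none = S , ind , λ i i∉S → decidable-stable (dependentRows? M (S ∪ ⁅ i ⁆)) λ ind′ → none (i , i∉S , ind′)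
    ... | yes (i , i∉S , ind′) = grow fuel (S ∪ ⁅ i ⁆)
      (ℕ.≤-trans p≤ (ℕ.≤-trans (ℕ.≤-reflexive (ℕ.+-suc ∣ S ∣ fuel))
        (ℕ.+-monoˡ-≤ fuel (p⊂q⇒∣p∣<∣q∣ (p⊆p∪q ⁅ i ⁆ , i , q⊆p∪q S ⁅ i ⁆ (x∈⁅x⁆ i) , i∉S)))))
      ind′

  maximalIndependent : ∃[ S ] Independent S × Maximal S
  maximalIndependent = grow p ⊥ (ℕ.m≤n+m p _) λ (_ , C⊆⊥ , (_ , i∈C) , _) → ∉⊥ (C⊆⊥ i∈C)

  -- If column j vanished on all rows of S, a dependency C among S and row i, read in column j,
  -- would reduce to its term at i. As `M i j` is 1, this forces i ∉ C, and C would already be a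
  -- dependency inside S.
  maximal⇒hits : ∀ {S} → Independent S → Maximal S → ∀ {i j} → M i j ≡ true → ∃[ s ] s ∈ S × M s j ≡ true
  maximal⇒hits {S} ind max {i} {j} Mij with i ∈? S
  ... | yes i∈S = i , i∈S , Mij
  ... | no  i∉S with any? (λ s → (s ∈? S) ×-dec (M s j Bool.≟ true)) | max i i∉S
  ... | yes hit  | _ = hit
  ... | no  miss | C , C⊆S∪i , C≢∅ , C≡0 = contradiction (C , (λ {s} → C⊆S {s}) , C≢∅ , C≡0) ind
    where
    in-S : ∀ {s} → s ∈ C → s ≢ i → s ∈ S
    in-S s∈C s≢i with x∈p∪q⁻ S ⁅ i ⁆ (C⊆S∪i s∈C)
    ... | inj₁ s∈S = s∈S
    ... | inj₂ s∈i = contradiction (x∈⁅y⁆⇒x≡y i s∈i) s≢i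

    off-i : ∀ s → s ≢ i → Vec.lookup C s ∧ M s j ≡ false
    off-i s s≢i with Vec.lookup C s in eq
    ... | false = refl
    ... | true  = Bool.¬-not λ Msj → miss (s , in-S (lookup⇒[]= s C eq) s≢i , Msj)

    Ci≡0 : Vec.lookup C i ≡ false
    Ci≡0 = begin
      Vec.lookup C i          ≡⟨ Bool.∧-identityʳ _ ⟨
      Vec.lookup C i ∧ true   ≡⟨ cong (Vec.lookup C i ∧_) Mij ⟨
      Vec.lookup C i ∧ M i j  ≡⟨ ∑₂-single i off-i ⟨
      rowSum M C j            ≡⟨ C≡0 j ⟩
      false                   ∎
      where open ≡-Reasoning

    C⊆S : C ⊆ S
    C⊆S s∈C = in-S s∈C λ { refl → contradiction (trans (sym Ci≡0) ([]=⇒lookup s∈C)) λ () }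

  -- The rows of a maximal independent set are nonzero in every nonzero column.
  ones≤rank : ∀ {d} → (∀ i → (sum λ j → 𝟙 (M i j)) ℕ.≤ d) → (∀ j → (sum λ i → 𝟙 (M i j)) ℕ.≤ d) →
              (sum λ i → sum λ j → 𝟙 (M i j)) ℕ.≤ rank₂ M * (d * d)
  ones≤rank {d} row≤d col≤d with maximalIndependent
  ... | S , ind , max = begin
    (sum λ i → sum λ j → 𝟙 (M i j))                        ≡⟨ ∑-comm (λ i j → 𝟙 (M i j)) ⟩
    (sum λ j → sum λ i → 𝟙 (M i j))                        ≤⟨ sum-mono column ⟩
    (sum λ j → d * sum λ s → χ s * 𝟙 (M s j))              ≡⟨ *-distribˡ-sum d (λ j → sum λ s → χ s * 𝟙 (M s j)) ⟨
    d * (sum λ j → sum λ s → χ s * 𝟙 (M s j))              ≡⟨ cong (d *_) (∑-comm (λ j s → χ s * 𝟙 (M s j))) ⟩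
    d * (sum λ s → sum λ j → χ s * 𝟙 (M s j))              ≡⟨ cong (d *_) (sum-cong-≗ λ s → *-distribˡ-sum (χ s) (λ j → 𝟙 (M s j))) ⟨
    d * (sum λ s → χ s * sum λ j → 𝟙 (M s j))              ≤⟨ ℕ.*-monoʳ-≤ d (sum-mono λ s → ℕ.*-monoʳ-≤ (χ s) (row≤d s)) ⟩
    d * (sum λ s → χ s * d)                                ≡⟨ cong (d *_) (*-distribʳ-sum d χ) ⟨
    d * (sum χ * d)                                        ≡⟨ cong (λ c → d * (c * d)) (∣∣≡sum S) ⟨
    d * (∣ S ∣ * d)                                        ≤⟨ ℕ.*-monoʳ-≤ d (ℕ.*-monoˡ-≤ d (independent≤rank ind)) ⟩
    d * (rank₂ M * d)                                      ≡⟨ ring d (rank₂ M) ⟩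
    rank₂ M * (d * d)                                      ∎
    where
    open ℕ.≤-Reasoning
    χ : Fin p → ℕ
    χ s = 𝟙 (Vec.lookup S s)
    ring : ∀ d r → d * (r * d) ≡ r * (d * d)
    ring = ℕ-Solver.solve-∀
    -- A nonzero column has at most `d` ones altogether and at least one of them in a row of `S`; a
    -- zero column contributes nothing.
    column : ∀ j → (sum λ i → 𝟙 (M i j)) ℕ.≤ d * sum λ s → χ s * 𝟙 (M s j)
    column j with any? (λ i → M i j Bool.≟ true)
    ... | no none = ℕ.≤-trans
      (ℕ.≤-reflexive (trans (sum-cong-≗ λ i → cong 𝟙 (Bool.¬-not λ Mij → none (i , Mij))) (trans (sum-const p 0) (ℕ.*-zeroʳ p)))) z≤n
    ... | yes (i , Mij) with maximal⇒hits ind max Mij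
    ... | s , s∈S , Msj = begin
      (sum λ i → 𝟙 (M i j))               ≤⟨ col≤d j ⟩
      d                                   ≡⟨ ℕ.*-identityʳ d ⟨
      d * 1                               ≡⟨ cong (d *_) (cong₂ (λ a b → 𝟙 a * 𝟙 b) ([]=⇒lookup s∈S) Msj) ⟨
      d * (χ s * 𝟙 (M s j))               ≤⟨ ℕ.*-monoʳ-≤ d (term≤sum (λ s → χ s * 𝟙 (M s j)) s) ⟩
      d * (sum λ s → χ s * 𝟙 (M s j))     ∎

-- Sums over positions in a list of vertices

module _ {A : Set} (g : A → ℕ) where

  -- Indexed by positions instead of recursion on the list, because the rows and columns of the
  -- matrix in `cutRank` are positions in `elements X` and `elements (∁ X)`.
  sumList : List A → ℕ
  sumList xs = sum λ i → g (List.lookup xs i)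

  sumList-filter : ∀ {P : Pred A 0ℓ} (P? : Decidable P) xs →
                   sumList (filter P? xs) ≡ sum λ i → 𝟙 (does (P? (List.lookup xs i))) * g (List.lookup xs i)
  sumList-filter P? []       = refl
  sumList-filter P? (x ∷ xs) with does (P? x)
  ... | true  = cong₂ _+_ (sym (ℕ.+-identityʳ (g x))) (sumList-filter P? xs)
  ... | false = sumList-filter P? xs

sumList-tabulate : ∀ {A : Set} {n} (g : A → ℕ) (f : Fin n → A) → sumList g (List.tabulate f) ≡ sum (g ∘ f)
sumList-tabulate {n = zero}  g f = refl
sumList-tabulate {n = suc n} g f = cong (g (f zero) +_) (sumList-tabulate g (f ∘ suc))

sum-elements : ∀ {n} (X : Subset n) (g : Fin n → ℕ) → sumList g (elements X) ≡ sum λ x → 𝟙 (Vec.lookup X x) * g x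
sum-elements {n} X g = begin
  sumList g (elements X)                                    ≡⟨ sumList-filter g (_∈? X) (allFin n) ⟩
  sumList (λ x → 𝟙 (does (x ∈? X)) * g x) (allFin n)        ≡⟨ sumList-tabulate (λ x → 𝟙 (does (x ∈? X)) * g x) id ⟩
  (sum λ x → 𝟙 (does (x ∈? X)) * g x)                       ≡⟨ sum-cong-≗ (λ x → cong (λ b → 𝟙 b * g x) (does-∈? x X)) ⟩
  (sum λ x → 𝟙 (Vec.lookup X x) * g x)                      ∎
  where open ≡-Reasoning

sep-∁ : ∀ {n} (X : Subset n) x y → sep (Vec.lookup X) x y ≡ 𝟙 (Vec.lookup X x) * 𝟙 (Vec.lookup (∁ X) y)
sep-∁ X x y = trans (𝟙-∧ (Vec.lookup X x) (not (Vec.lookup X y))) (cong (λ b → 𝟙 (Vec.lookup X x) * 𝟙 b) (sym (lookup-map y not X)))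

-- The ones of the matrix behind `cutRank` are the cut edges, and each of its rows and columns lists
-- part of the neighbourhood of one vertex.
cut≤cutRank : ∀ {n} (G : Graph n) {d} → MaxDegree G d → ∀ X → cut G (Vec.lookup X) ℕ.≤ cutRank G X * (d * d)
cut≤cutRank {n} G {d} deg≤d X = begin
  cut G (Vec.lookup X)
    ≡⟨ sum-cong-≗ (λ x → trans (sum-cong-≗ λ y → trans (cong (adj G x y *_) (sep-∁ X x y)) (ring (adj G x y) (χ x) (χ′ y)))
         (sym (*-distribˡ-sum (χ x) (λ y → χ′ y * adj G x y)))) ⟩
  (sum λ x → χ x * sum λ y → χ′ y * adj G x y)
    ≡⟨ sum-elements X (λ x → sum λ y → χ′ y * adj G x y) ⟨
  sumList (λ x → sum λ y → χ′ y * adj G x y) (elements X)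
    ≡⟨ sum-cong-≗ (λ i → sum-elements (∁ X) (adj G (List.lookup (elements X) i))) ⟨
  (sum λ i → sum λ j → 𝟙 (M i j))
    ≤⟨ ones≤rank M row col ⟩
  cutRank G X * (d * d) ∎
  where
  open ℕ.≤-Reasoning
  χ χ′ : Fin n → ℕ
  χ  x = 𝟙 (Vec.lookup X x)
  χ′ y = 𝟙 (Vec.lookup (∁ X) y)
  M : Matrix₂ (length (elements X)) (length (elements (∁ X)))
  M i j = does (Graph._~?_ G (List.lookup (elements X) i) (List.lookup (elements (∁ X)) j))
  ring : ∀ a b c → a * (b * c) ≡ b * (c * a)
  ring = ℕ-Solver.solve-∀
  row : ∀ i → (sum λ j → 𝟙 (M i j)) ℕ.≤ d
  row i = begin
    sumList (adj G x) (elements (∁ X))   ≡⟨ sum-elements (∁ X) (adj G x) ⟩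
    (sum λ y → χ′ y * adj G x y)         ≤⟨ sum-mono (λ y → 𝟙*n≤n (Vec.lookup (∁ X) y) (adj G x y)) ⟩
    sum (adj G x)                        ≤⟨ deg≤d x ⟩
    d                                    ∎
    where x = List.lookup (elements X) i
  col : ∀ j → (sum λ i → 𝟙 (M i j)) ℕ.≤ d
  col j = begin
    sumList (λ x → adj G x y) (elements X)   ≡⟨ sum-elements X (λ x → adj G x y) ⟩
    (sum λ x → χ x * adj G x y)              ≤⟨ sum-mono (λ x → 𝟙*n≤n (Vec.lookup X x) (adj G x y)) ⟩
    (sum λ x → adj G x y)                    ≡⟨ sum-cong-≗ (λ x → adj-sym G x y) ⟩
    sum (adj G y)                            ≤⟨ deg≤d y ⟩
    d                                        ∎
    where y = List.lookup (elements (∁ X)) j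

pairs≡∣X∣*∣∁X∣ : ∀ {n} (X : Subset n) → pairs (Vec.lookup X) ≡ ∣ X ∣ * ∣ ∁ X ∣
pairs≡∣X∣*∣∁X∣ X = begin
  pairs (Vec.lookup X)                                             ≡⟨ sum-cong₂ (sep-∁ X) ⟩
  (sum λ x → sum λ y → χ x * χ′ y)                                 ≡⟨ sum-cong-≗ (λ x → *-distribˡ-sum (χ x) χ′) ⟨
  (sum λ x → χ x * sum χ′)                                         ≡⟨ *-distribʳ-sum (sum χ′) χ ⟨
  sum χ * sum χ′                                                   ≡⟨ cong₂ _*_ (∣∣≡sum X) (∣∣≡sum (∁ X)) ⟨
  ∣ X ∣ * ∣ ∁ X ∣                                                  ∎
  where
  open ≡-Reasoning
  χ = λ x → 𝟙 (Vec.lookup X x)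
  χ′ = λ y → 𝟙 (Vec.lookup (∁ X) y)

-- Balanced edges of cubic trees

𝟙-does-≤ : ∀ {P : Set} (P? : Dec P) {k} → (P → 1 ℕ.≤ k) → 𝟙 (does P?) ℕ.≤ k
𝟙-does-≤ (yes p) 1≤k = 1≤k p
𝟙-does-≤ (no _)  _   = z≤n

𝟙*-mono : ∀ {P : Set} (P? : Dec P) {k l} → (P → k ℕ.≤ l) → 𝟙 (does P?) * k ℕ.≤ 𝟙 (does P?) * l
𝟙*-mono (yes p) k≤l = ℕ.*-monoʳ-≤ 1 (k≤l p)
𝟙*-mono (no _)  _   = z≤n

𝟙-complementary : ∀ {P Q : Set} (P? : Dec P) (Q? : Dec Q) → P ⊎ Q → (P → ¬ Q) → 𝟙 (does P?) + 𝟙 (does Q?) ≡ 1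
𝟙-complementary (yes p) (yes q) _   ¬pq = contradiction q (¬pq p)
𝟙-complementary (yes _) (no _)  _   _   = refl
𝟙-complementary (no _)  (yes _) _   _   = refl
𝟙-complementary (no ¬p) (no ¬q) p⊎q _   = contradiction p⊎q Sum.[ ¬p , ¬q ]

module _ {n} (G : Graph n) where
  open Graph G using (_~_)

  -- A walk without repeated vertices, indexed by its vertex list, so that `lookup` in that list is
  -- the injective vertex function which `Cycle` asks for.
  data Path : Fin n → Fin n → List (Fin n) → Set where
    [_]  : ∀ x → Path x x (x ∷ [])
    cons : ∀ {x y z vs} → x ~ z → x ∉ˡ vs → Path z y vs → Path x y (x ∷ vs)

  suffix : ∀ {x y z vs} → x ∈ˡ vs → Path z y vs → ∃[ ws ] Path x y ws
  suffix (here refl)  [ x ]            = _ , [ x ]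
  suffix (here refl)  p@(cons _ _ _)   = _ , p
  suffix (there x∈vs) (cons _ _ p)     = suffix x∈vs p

  -- If the new first vertex already occurs on the path, the closed detour back to it is dropped by
  -- keeping the suffix from that occurrence.
  eraseLoops : ∀ {x y} → Reachable G x y → ∃[ vs ] Path x y vs
  eraseLoops ε = _ , [ _ ]
  eraseLoops (_◅_ {i = x} x~z w) with eraseLoops w
  ... | vs , p with DecMembership._∈?_ _≟_ x vs
  ... | yes x∈vs = suffix x∈vs p
  ... | no  x∉vs = _ , cons x~z x∉vs p

  path-head : ∀ {x y v vs} → Path x y (v ∷ vs) → x ≡ v
  path-head [ _ ]        = refl
  path-head (cons _ _ _) = refl

  path-last : ∀ {x y v vs} → Path x y (v ∷ vs) → List.lookup (v ∷ vs) (fromℕ (length vs)) ≡ y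
  path-last [ _ ]                    = refl
  path-last {vs = _ ∷ _} (cons _ _ p) = path-last p

  path-step : ∀ {x y v vs} → Path x y (v ∷ vs) → ∀ i →
              List.lookup (v ∷ vs) (inject₁ i) ~ List.lookup (v ∷ vs) (suc i)
  path-step {vs = _ ∷ _} (cons x~z _ p) zero    = subst (_ ~_) (path-head p) x~z
  path-step {vs = _ ∷ _} (cons _   _ p) (suc i) = path-step p i

  path-injective : ∀ {x y vs} → Path x y vs → ∀ {i j} → List.lookup vs i ≡ List.lookup vs j → i ≡ j
  path-injective [ _ ]          {zero}  {zero}  _  = refl
  path-injective (cons _ _ _)   {zero}  {zero}  _  = refl
  path-injective (cons _ x∉ _)  {zero}  {suc j} eq = contradiction (subst (_∈ˡ _) (sym eq) (∈-lookup j)) x∉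
  path-injective (cons _ x∉ _)  {suc i} {zero}  eq = contradiction (subst (_∈ˡ _) eq (∈-lookup i)) x∉
  path-injective (cons _ _ p)   {suc i} {suc j} eq = cong suc (path-injective p eq)

-- The two sides of a tree edge

module Tree {n} (T : Graph n) (isTree : IsTree T) where
  open Graph T using (_~_; _~?_)

  Side : Fin n → Fin n → Fin n → Set
  Side a b t = Reachable (deleteEdge T (a , b)) a t

  side? : ∀ a b t → Dec (Side a b t)
  side? a b = reachable? (deleteEdge T (a , b)) a

  flip : ∀ {a b x y} → Reachable (deleteEdge T (a , b)) x y → Reachable (deleteEdge T (b , a)) x y
  flip = Star.map λ (x~y , ¬same) → x~y , ¬same ∘ Sum.swap

  path⇒cycle : ∀ {a b v₁ v₂ v₃ vs} → a ~ b → Path (deleteEdge T (a , b)) a b (v₁ ∷ v₂ ∷ v₃ ∷ vs) → Cycle T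
  path⇒cycle {v₁ = v₁} {v₂} {v₃} {vs} a~b p = record
    { vertex    = List.lookup (v₁ ∷ v₂ ∷ v₃ ∷ vs)
    ; injective = path-injective _ p
    ; step      = proj₁ ∘ path-step _ p
    ; close     = subst₂ _~_ (sym (path-last _ p)) (path-head _ p) (~-sym T a~b) }

  -- A path from a to b without the edge ab has one vertex, making ab a loop; or two, making it the
  -- deleted edge itself; or more, and then ab closes it to a cycle. So every edge of a tree is a
  -- bridge.
  other-end : ∀ {a b} → a ~ b → ¬ Side a b b
  other-end a~b r with eraseLoops _ r
  ... | _ , [ _ ]                                 = ~-irr T a~b
  ... | _ , cons (_ , ¬same) _ [ _ ]              = ¬same (inj₁ (refl , refl))
  ... | _ , p@(cons _ _ (cons _ _ [ _ ]))         = proj₂ isTree (path⇒cycle a~b p)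
  ... | _ , p@(cons _ _ (cons _ _ (cons _ _ _)))  = proj₂ isTree (path⇒cycle a~b p)

  -- A walk from a to t in the tree is cut after its last use of the edge ab; what remains starts at
  -- a or at b.
  sides-cover : ∀ a b t → Side a b t ⊎ Side b a t
  sides-cover a b t with follow (proj₁ isTree a t)
    where
    D = deleteEdge T (a , b)
    follow : ∀ {x} → Reachable T x t → Reachable D x t ⊎ (Reachable D a t ⊎ Reachable D b t)
    follow ε = inj₁ ε
    follow (_◅_ {i = x} {j = z} x~z w) with follow w
    ... | inj₂ r = inj₂ r
    ... | inj₁ r with ((x ≟ a) ×-dec (z ≟ b)) ⊎-dec ((x ≟ b) ×-dec (z ≟ a))
    ... | no ¬same                 = inj₁ ((x~z , ¬same) ◅ r)
    ... | yes (inj₁ (_ , refl))    = inj₂ (inj₂ r)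
    ... | yes (inj₂ (_ , refl))    = inj₂ (inj₁ r)
  ... | inj₁ r        = inj₁ r
  ... | inj₂ (inj₁ r) = inj₁ r
  ... | inj₂ (inj₂ r) = inj₂ (flip r)

  sides-disjoint : ∀ {a b t} → a ~ b → Side a b t → ¬ Side b a t
  sides-disjoint {a} {b} a~b r s = other-end a~b (r ◅◅ Star.reverse (~-sym (deleteEdge T (a , b))) (flip s))

  -- Cut a walk at its last visit to a.
  side-branches : ∀ {a b t} → Side a b t → t ≡ a ⊎ ∃[ c ] a ~ c × c ≢ b × Side c a t
  side-branches {a} {b} {t} r with follow r
    where
    Avoiding : Fin n → Fin n → Set
    Avoiding u v = u ~ v × u ≢ a × v ≢ a
    follow : ∀ {x} → Reachable (deleteEdge T (a , b)) x t →
             t ≡ a ⊎ (∃[ c ] a ~ c × c ≢ b × Side c a t) ⊎ (x ≢ a × Star Avoiding x t)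
    follow ε with t ≟ a
    ... | yes t≡a = inj₁ t≡a
    ... | no  t≢a = inj₂ (inj₂ (t≢a , ε))
    follow (_◅_ {i = x} {j = z} (x~z , ¬same) w) with follow w
    ... | inj₁ t≡a               = inj₁ t≡a
    ... | inj₂ (inj₁ branch)     = inj₂ (inj₁ branch)
    ... | inj₂ (inj₂ (z≢a , av)) with x ≟ a
    ... | yes refl = inj₂ (inj₁ (z , x~z , (λ z≡b → ¬same (inj₁ (refl , z≡b))) ,
      Star.map (λ (u~v , u≢a , v≢a) → u~v , λ { (inj₁ (_ , v≡a)) → v≢a v≡a ; (inj₂ (u≡a , _)) → u≢a u≡a }) av))
    ... | no  x≢a  = inj₂ (inj₂ (x≢a , (x~z , x≢a , z≢a) ◅ av))
  ... | inj₁ t≡a              = inj₁ t≡a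
  ... | inj₂ (inj₁ branch)    = inj₂ branch
  ... | inj₂ (inj₂ (a≢a , _)) = contradiction refl a≢a

  -- Since ca is a bridge, the side of c never reaches a and hence never uses ab. The walk made so
  -- far is carried along as `pre` to witness this at each step.
  side-nested : ∀ {a b c t} → a ~ b → a ~ c → c ≢ b → Side c a t → Side a b t
  side-nested {a} {b} {c} a~b a~c c≢b r = (a~c , λ
    { (inj₁ (_ , c≡b)) → c≢b c≡b
    ; (inj₂ (refl , _)) → ~-irr T a~b }) ◅ follow ε r
    where
    follow : ∀ {x t} → Side c a x → Reachable (deleteEdge T (c , a)) x t → Reachable (deleteEdge T (a , b)) x t
    follow pre ε = ε
    follow {x} pre (_◅_ {j = z} x~z w) = (proj₁ x~z , λ
      { (inj₁ (refl , _)) → other-end (~-sym T a~c) pre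
      ; (inj₂ (_ , refl)) → other-end (~-sym T a~c) pre′ }) ◅ follow pre′ w
      where pre′ = pre ◅◅ x~z ◅ ε

  sideSet : Fin n → Fin n → Subset n
  sideSet a b = Vec.tabulate λ t → does (side? a b t)

  ∈-sideSet⁺ : ∀ {a b t} → Side a b t → t ∈ sideSet a b
  ∈-sideSet⁺ {a} {b} {t} r = lookup⇒[]= t (sideSet a b) (trans (lookup∘tabulate _ t) (dec-true (side? a b t) r))

  ∈-sideSet⁻ : ∀ {a b t} → t ∈ sideSet a b → Side a b t
  ∈-sideSet⁻ {a} {b} {t} t∈ with side? a b t in eq
  ... | yes r = r
  ... | no  _ = contradiction (trans (sym ([]=⇒lookup t∈)) (trans (lookup∘tabulate _ t) (cong does eq))) λ ()

  -- The node `a` itself is lost. The size of `sideSet` is the measure that bounds the recursion in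
  -- `descend`.
  sideSet-shrinks : ∀ {a b c} → a ~ b → a ~ c → c ≢ b → ∣ sideSet c a ∣ ℕ.< ∣ sideSet a b ∣
  sideSet-shrinks {a} a~b a~c c≢b = p⊂q⇒∣p∣<∣q∣
    ( (λ t∈ → ∈-sideSet⁺ (side-nested a~b a~c c≢b (∈-sideSet⁻ t∈)))
    , a , ∈-sideSet⁺ ε , λ a∈ → other-end (~-sym T a~c) (∈-sideSet⁻ a∈) )

  branch? : ∀ a b c → Dec (a ~ c × c ≢ b)
  branch? a b c = (a ~? c) ×-dec ¬? (c ≟ b)

  branches : Fin n → Fin n → ℕ
  branches a b = sum λ c → 𝟙 (does (branch? a b c))

  degree≡sum : ∀ a → degree T a ≡ sum (adj T a)
  degree≡sum a = ∣tabulate∣≡sum λ c → does (a ~? c)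

  degree≡1+branches : ∀ {a b} → a ~ b → degree T a ≡ 1 + branches a b
  degree≡1+branches {a} {b} a~b = begin
    degree T a                                                     ≡⟨ degree≡sum a ⟩
    sum (adj T a)                                                  ≡⟨ sum-cong-≗ split ⟩
    (sum λ c → 𝟙 (does (b ≟ c)) * 1 + 𝟙 (does (branch? a b c)))    ≡⟨ ∑-distrib-+ (λ c → 𝟙 (does (b ≟ c)) * 1) (λ c → 𝟙 (does (branch? a b c))) ⟩
    (sum λ c → 𝟙 (does (b ≟ c)) * 1) + branches a b                ≡⟨ cong (_+ branches a b) (sum-δ b (λ _ → 1)) ⟩
    1 + branches a b                                               ∎
    where
    open ≡-Reasoning
    split : ∀ c → adj T a c ≡ 𝟙 (does (b ≟ c)) * 1 + 𝟙 (does (branch? a b c))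
    split c with b ≟ c | a ~? c | c ≟ b
    ... | yes _    | yes _   | yes _   = refl
    ... | yes refl | no a≁b  | _       = contradiction a~b a≁b
    ... | yes refl | yes _   | no b≢b  = contradiction refl b≢b
    ... | no b≢c   | yes _   | yes c≡b = contradiction (sym c≡b) b≢c
    ... | no _     | yes _   | no _    = refl
    ... | no _     | no _    | _       = refl

module Balanced {n m} (T : Graph n) (isTree : IsTree T) (cubic : ∀ t → degree T t ≡ 1 ⊎ degree T t ≡ 3)
  (node : Fin m → Fin n) (node-leaf : ∀ v → degree T (node v) ≡ 1)
  (node-injective : ∀ {u v} → node u ≡ node v → u ≡ v) where
  open Graph T using (_~_; _~?_)
  open Tree T isTree

  weight : Fin n → Fin n → ℕ
  weight a b = sum λ v → 𝟙 (does (side? a b (node v)))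

  weight-sides : ∀ {a b} → a ~ b → weight a b + weight b a ≡ m
  weight-sides {a} {b} a~b = begin
    weight a b + weight b a   ≡⟨ ∑-distrib-+ (λ v → 𝟙 (does (side? a b (node v)))) (λ v → 𝟙 (does (side? b a (node v)))) ⟨
    (sum λ v → 𝟙 (does (side? a b (node v))) + 𝟙 (does (side? b a (node v))))  ≡⟨ sum-cong-≗ (λ v → one (node v)) ⟩
    sum {m} (λ _ → 1)         ≡⟨ sum-const m 1 ⟩
    m * 1                     ≡⟨ ℕ.*-identityʳ m ⟩
    m                         ∎
    where
    open ≡-Reasoning
    one : ∀ t → 𝟙 (does (side? a b t)) + 𝟙 (does (side? b a t)) ≡ 1
    one t = 𝟙-complementary (side? a b t) (side? b a t) (sides-cover a b t) (sides-disjoint a~b)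

  leavesAt : Fin n → ℕ
  leavesAt a = sum λ v → 𝟙 (does (node v ≟ a))

  leavesAt≤1 : ∀ a → leavesAt a ℕ.≤ 1
  leavesAt≤1 a with any? (λ v → node v ≟ a)
  ... | no none = ℕ.≤-trans (ℕ.≤-reflexive (trans (sum-cong-≗ λ v → 𝟙-does-no (node v ≟ a) (none ∘ (v ,_)))
                              (trans (sum-const m 0) (ℕ.*-zeroʳ m)))) z≤n
  ... | yes (v₀ , refl) = ℕ.≤-reflexive (trans
    (sum-cong-≗ λ v → trans (𝟙-does-⇔ (node v ≟ node v₀) (v₀ ≟ v) (sym ∘ node-injective) (sym ∘ cong node)) (sym (ℕ.*-identityʳ _)))
    (sum-δ v₀ (λ _ → 1)))

  leavesAt-inner : ∀ {a} → degree T a ≡ 3 → leavesAt a ≡ 0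
  leavesAt-inner {a} deg≡3 = trans
    (sum-cong-≗ λ v → 𝟙-does-no (node v ≟ a) λ { refl → contradiction (trans (sym deg≡3) (node-leaf v)) λ () })
    (trans (sum-const m 0) (ℕ.*-zeroʳ m))

  weight-branches : ∀ {a b} → weight a b ℕ.≤ leavesAt a + sum λ c → 𝟙 (does (branch? a b c)) * weight c a
  weight-branches {a} {b} = begin
    weight a b
      ≤⟨ sum-mono (λ v → bound-at (node v)) ⟩
    (sum λ v → 𝟙 (does (node v ≟ a)) + sum λ c → B c * 𝟙 (does (side? c a (node v))))
      ≡⟨ ∑-distrib-+ (λ v → 𝟙 (does (node v ≟ a))) (λ v → sum λ c → B c * 𝟙 (does (side? c a (node v)))) ⟩
    leavesAt a + (sum λ v → sum λ c → B c * 𝟙 (does (side? c a (node v))))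
      ≡⟨ cong (leavesAt a +_) (∑-comm (λ v c → B c * 𝟙 (does (side? c a (node v))))) ⟩
    leavesAt a + (sum λ c → sum λ v → B c * 𝟙 (does (side? c a (node v))))
      ≡⟨ cong (leavesAt a +_) (sum-cong-≗ λ c → *-distribˡ-sum (B c) (λ v → 𝟙 (does (side? c a (node v))))) ⟨
    leavesAt a + (sum λ c → B c * weight c a) ∎
    where
    open ℕ.≤-Reasoning
    B : Fin n → ℕ
    B c = 𝟙 (does (branch? a b c))
    bound-at : ∀ t → 𝟙 (does (side? a b t)) ℕ.≤ 𝟙 (does (t ≟ a)) + sum λ c → B c * 𝟙 (does (side? c a t))
    bound-at t = 𝟙-does-≤ (side? a b t) λ r → positive (side-branches r)
      where
      positive : t ≡ a ⊎ (∃[ c ] a ~ c × c ≢ b × Side c a t) → 1 ℕ.≤ 𝟙 (does (t ≟ a)) + sum λ c → B c * 𝟙 (does (side? c a t))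
      positive (inj₁ t≡a) = ℕ.≤-trans (ℕ.≤-reflexive (sym (𝟙-does-yes (t ≟ a) t≡a))) (ℕ.m≤m+n _ _)
      positive (inj₂ (c , a~c , c≢b , s)) = begin
        1                                  ≡⟨ cong₂ _*_ (𝟙-does-yes (branch? a b c) (a~c , c≢b)) (𝟙-does-yes (side? c a t) s) ⟨
        B c * 𝟙 (does (side? c a t))         ≤⟨ term≤sum (λ c → B c * 𝟙 (does (side? c a t))) c ⟩
        (sum λ c → B c * 𝟙 (does (side? c a t)))  ≤⟨ ℕ.m≤n+m _ _ ⟩
        𝟙 (does (t ≟ a)) + (sum λ c → B c * 𝟙 (does (side? c a t))) ∎

  -- A node of degree three carries no vertex and has two branches besides b; if each held at most
  -- m/3, the side of a would hold at most 2m/3. A leaf has no such branch and carries at most one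
  -- vertex, and 3 ≤ 2m because 2 ≤ m.
  heavyBranch : 2 ℕ.≤ m → ∀ {a b} → a ~ b → 2 * m ℕ.< 3 * weight a b → ∃[ c ] a ~ c × c ≢ b × m ℕ.≤ 3 * weight c a
  heavyBranch 2≤m {a} {b} a~b heavy
    with any? (λ c → (a ~? c) ×-dec ¬? (c ≟ b) ×-dec (m ℕ.≤? 3 * weight c a))
  ... | yes found = found
  ... | no  none  = contradiction heavy (ℕ.≤⇒≯ light)
    where
    open ℕ.≤-Reasoning
    B : Fin n → ℕ
    B c = 𝟙 (does (branch? a b c))
    small : ∀ c → B c * (3 * weight c a) ℕ.≤ B c * m
    small c = 𝟙*-mono (branch? a b c) λ (a~c , c≢b) → ℕ.≰⇒≥ λ m≤ → none (c , a~c , c≢b , m≤)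
    ring : ∀ b w → 3 * (b * w) ≡ b * (3 * w)
    ring = ℕ-Solver.solve-∀
    estimate : 3 * weight a b ℕ.≤ 3 * leavesAt a + branches a b * m
    estimate = begin
      3 * weight a b                                                ≤⟨ ℕ.*-monoʳ-≤ 3 weight-branches ⟩
      3 * (leavesAt a + sum λ c → B c * weight c a)                 ≡⟨ ℕ.*-distribˡ-+ 3 (leavesAt a) _ ⟩
      3 * leavesAt a + 3 * (sum λ c → B c * weight c a)             ≡⟨ cong (3 * leavesAt a +_) (*-distribˡ-sum 3 (λ c → B c * weight c a)) ⟩
      3 * leavesAt a + (sum λ c → 3 * (B c * weight c a))           ≡⟨ cong (3 * leavesAt a +_) (sum-cong-≗ λ c → ring (B c) (weight c a)) ⟩
      3 * leavesAt a + (sum λ c → B c * (3 * weight c a))           ≤⟨ ℕ.+-monoʳ-≤ (3 * leavesAt a) (sum-mono small) ⟩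
      3 * leavesAt a + (sum λ c → B c * m)                          ≡⟨ cong (3 * leavesAt a +_) (*-distribʳ-sum m B) ⟨
      3 * leavesAt a + branches a b * m                             ∎
    light : 3 * weight a b ℕ.≤ 2 * m
    light with cubic a
    ... | inj₁ deg≡1 = begin
      3 * weight a b                      ≤⟨ estimate ⟩
      3 * leavesAt a + branches a b * m   ≡⟨ cong (λ k → 3 * leavesAt a + k * m) (ℕ.suc-injective (trans (sym (degree≡1+branches a~b)) deg≡1)) ⟩
      3 * leavesAt a + 0                  ≤⟨ ℕ.+-monoˡ-≤ 0 (ℕ.*-monoʳ-≤ 3 (leavesAt≤1 a)) ⟩
      3                                   ≤⟨ s≤s (s≤s (s≤s z≤n)) ⟩
      2 * 2                               ≤⟨ ℕ.*-monoʳ-≤ 2 2≤m ⟩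
      2 * m                               ∎
    ... | inj₂ deg≡3 = begin
      3 * weight a b                      ≤⟨ estimate ⟩
      3 * leavesAt a + branches a b * m   ≡⟨ cong₂ (λ l k → 3 * l + k * m) (leavesAt-inner deg≡3)
                                               (ℕ.suc-injective (trans (sym (degree≡1+branches a~b)) deg≡3)) ⟩
      2 * m                               ∎

  IsBalanced : Fin n → Fin n → Set
  IsBalanced a b = a ~ b × m ℕ.≤ 3 * weight a b × m ℕ.≤ 3 * weight b a

  light⇒heavy : ∀ {a b} → a ~ b → 3 * weight a b ℕ.< m → 2 * m ℕ.< 3 * weight b a
  light⇒heavy {a} {b} a~b light = ℕ.+-cancelˡ-< (3 * weight a b) _ _ (begin-strict
    3 * weight a b + 2 * m            <⟨ ℕ.+-monoˡ-< (2 * m) light ⟩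
    3 * m                             ≡⟨ cong (3 *_) (weight-sides a~b) ⟨
    3 * (weight a b + weight b a)     ≡⟨ ℕ.*-distribˡ-+ 3 (weight a b) (weight b a) ⟩
    3 * weight a b + 3 * weight b a   ∎)
    where open ℕ.≤-Reasoning

  -- The invariant is that the side of a holds more than two thirds of the vertices. The branch
  -- found at c holds at least a third; if the opposite side of its edge does not, the branch holds
  -- more than two thirds and, having fewer nodes, pays for the next round.
  descend : 2 ℕ.≤ m → ∀ fuel {a b} → ∣ sideSet a b ∣ ℕ.< fuel → a ~ b → 2 * m ℕ.< 3 * weight a b → ∃[ x ] ∃[ y ] IsBalanced x y
  descend 2≤m (suc fuel) {a} {b} (s≤s ∣side∣≤) a~b heavy with heavyBranch 2≤m a~b heavy
  ... | c , a~c , c≢b , m≤ with m ℕ.≤? 3 * weight a c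
  ... | yes m≤′ = c , a , ~-sym T a~c , m≤ , m≤′
  ... | no  m≰  = descend 2≤m fuel (ℕ.<-≤-trans (sideSet-shrinks a~b a~c c≢b) ∣side∣≤) (~-sym T a~c)
                    (light⇒heavy a~c (ℕ.≰⇒> m≰))

  balancedEdge : 2 ℕ.≤ m → ∀ {a b} → a ~ b → ∃[ x ] ∃[ y ] IsBalanced x y
  balancedEdge 2≤m {a} {b} a~b with m ℕ.≤? 3 * weight a b | m ℕ.≤? 3 * weight b a
  ... | yes p | yes q = a , b , a~b , p , q
  ... | no  p | _     = descend 2≤m _ ℕ.≤-refl (~-sym T a~b) (light⇒heavy a~b (ℕ.≰⇒> p))
  ... | yes _ | no q  = descend 2≤m _ ℕ.≤-refl a~b (light⇒heavy (~-sym T a~b) (ℕ.≰⇒> q))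

∈-edges : ∀ {n} (G : Graph n) {a b} → a Fin.< b → Graph._~_ G a b → (a , b) ∈ˡ edges G
∈-edges G {a} {b} a<b a~b = ∈-filter⁺ _ (∈-cartesianProduct⁺ (∈-allFin a) (∈-allFin b)) (a<b , a~b)

module _ {m} {G : Graph m} (D : RankDecomposition G) where
  open RankDecomposition D
  open Graph tree using (_~_; _~?_)

  node-injective : ∀ {u v} → node u ≡ node v → u ≡ v
  node-injective {u} {v} eq = Bijection.injective L (leaf-≡ (Bijection.to L u) (Bijection.to L v) eq)
    where
    leaf-≡ : (x y : Leaf) → proj₁ x ≡ proj₁ y → x ≡ y
    leaf-≡ (t , p) (.t , q) refl = cong (t ,_) (ℕ.≡-irrelevant p q)

  open Balanced tree isTree cubic node (λ v → proj₂ (Bijection.to L v)) node-injective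
  open Tree tree isTree

  ∣side∣ : ∀ a b → ∣ side (a , b) ∣ ≡ weight a b
  ∣side∣ a b = ∣tabulate∣≡sum λ v → does (side? a b (node v))

  ∣∁side∣ : ∀ {a b} → a ~ b → ∣ ∁ (side (a , b)) ∣ ≡ weight b a
  ∣∁side∣ {a} {b} a~b = begin
    ∣ ∁ (side (a , b)) ∣            ≡⟨ ∣∁p∣≡n∸∣p∣ (side (a , b)) ⟩
    m ℕ.∸ ∣ side (a , b) ∣          ≡⟨ cong₂ ℕ._∸_ (sym (weight-sides a~b)) (∣side∣ a b) ⟩
    weight a b + weight b a ℕ.∸ weight a b ≡⟨ ℕ.m+n∸m≡n (weight a b) (weight b a) ⟩
    weight b a                      ∎
    where open ≡-Reasoning

  someEdge : ∃[ a ] ∃[ b ] a ~ b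
  someEdge = first {T = tree} order≥2 (proj₁ isTree)
    where
    first : ∀ {n} {T : Graph n} → 2 ℕ.≤ n → Connected T → ∃[ a ] ∃[ b ] Graph._~_ T a b
    first (s≤s (s≤s z≤n)) conn with conn zero (suc zero)
    ... | e ◅ _ = _ , _ , e

  BalancedCut : Set
  BalancedCut = ∃[ e ] e ∈ˡ edges tree × m ℕ.≤ 3 * ∣ side e ∣ × m ℕ.≤ 3 * ∣ ∁ (side e) ∣

  balancedCut : 2 ℕ.≤ m → BalancedCut
  balancedCut 2≤m with someEdge
  ... | _ , _ , a~b with balancedEdge 2≤m a~b
  ... | x , y , x~y , p , q with Fin.<-cmp x y
  ... | tri< x<y _ _  = (x , y) , ∈-edges tree x<y x~y , subst (λ w → m ℕ.≤ 3 * w) (sym (∣side∣ x y)) p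
                      , subst (λ w → m ℕ.≤ 3 * w) (sym (∣∁side∣ x~y)) q
  ... | tri≈ _ refl _ = contradiction x~y (~-irr tree)
  -- `edges` lists an edge with its smaller end first, so the two sides and their estimates change
  -- places.
  ... | tri> _ _ y<x  = (y , x) , ∈-edges tree y<x (~-sym tree x~y) , subst (λ w → m ℕ.≤ 3 * w) (sym (∣side∣ y x)) q
                      , subst (λ w → m ℕ.≤ 3 * w) (sym (∣∁side∣ (~-sym tree x~y))) p

  cutRank≤width : ∀ {e} → e ∈ˡ edges tree → cutRank G (side e) ℕ.≤ width
  cutRank≤width e∈ = ∈⇒≤maximum (∈-map⁺ (λ e → cutRank G (side e)) e∈)

-- The rank-width bound

-- Writing 3x = n + p and 3y = n + q gives p + q = n, and hence 9xy = 2n² + pq. The constant 2 is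
-- attained at the extreme split into n/3 and 2n/3.
thirds⇒product : ∀ {n x y} → n ℕ.≤ 3 * x → n ℕ.≤ 3 * y → x + y ≡ n → 2 * (n * n) ℕ.≤ 9 * (x * y)
thirds⇒product {n} {x} {y} n≤3x n≤3y x+y≡n with ℕ.m≤n⇒∃[o]m+o≡n n≤3x | ℕ.m≤n⇒∃[o]m+o≡n n≤3y
... | p , n+p≡3x | q , n+q≡3y = begin
  2 * (n * n)                        ≡⟨ ring₁ n ⟩
  n * n + n * n                      ≡⟨ cong (λ s → n * n + n * s) p+q≡n ⟨
  n * n + n * (p + q)                ≤⟨ ℕ.m≤m+n _ (p * q) ⟩
  n * n + n * (p + q) + p * q        ≡⟨ ring₂ n p q ⟩
  (n + p) * (n + q)                  ≡⟨ cong₂ _*_ n+p≡3x n+q≡3y ⟩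
  3 * x * (3 * y)                    ≡⟨ ring₃ x y ⟩
  9 * (x * y)                        ∎
  where
  open ℕ.≤-Reasoning
  ring₁ : ∀ n → 2 * (n * n) ≡ n * n + n * n
  ring₁ = ℕ-Solver.solve-∀
  ring₂ : ∀ n p q → n * n + n * (p + q) + p * q ≡ (n + p) * (n + q)
  ring₂ = ℕ-Solver.solve-∀
  ring₃ : ∀ x y → 3 * x * (3 * y) ≡ 9 * (x * y)
  ring₃ = ℕ-Solver.solve-∀
  ring₄ : ∀ n p q → 2 * n + (p + q) ≡ n + p + (n + q)
  ring₄ = ℕ-Solver.solve-∀
  ring₅ : ∀ x y → 3 * x + 3 * y ≡ 2 * (x + y) + (x + y)
  ring₅ = ℕ-Solver.solve-∀
  p+q≡n : p + q ≡ n
  p+q≡n = ℕ.+-cancelˡ-≡ (2 * n) _ _ (begin-equality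
    2 * n + (p + q)          ≡⟨ ring₄ n p q ⟩
    n + p + (n + q)          ≡⟨ cong₂ _+_ n+p≡3x n+q≡3y ⟩
    3 * x + 3 * y            ≡⟨ ring₅ x y ⟩
    2 * (x + y) + (x + y)    ≡⟨ cong (λ s → 2 * s + s) x+y≡n ⟩
    2 * n + n                ∎)

cutRank-lowerBound : ∀ {n} .{{_ : NonZero n}} (G : Graph n) {d} → MaxDegree G d → DiameterTwo G → ∀ k (X : Subset (n ^ k)) →
                     n ^ k ℕ.≤ 3 * ∣ X ∣ → n ^ k ℕ.≤ 3 * ∣ ∁ X ∣ →
                     2 * (n * n ^ k) ℕ.≤ 9 * ((1 + 2 * d) * (cutRank (G □^ k) X * (k * d * (k * d))))
cutRank-lowerBound {n} G {d} deg≤d diam k X N≤3x N≤3y = ℕ.*-cancelˡ-≤ N {{ℕ.m^n≢0 n k}} (begin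
  N * (2 * (n * N))                    ≡⟨ ring₁ n N ⟩
  n * (2 * (N * N))                    ≤⟨ ℕ.*-monoʳ-≤ n (thirds⇒product {x = ∣ X ∣} {y = ∣ ∁ X ∣} N≤3x N≤3y ∣X∣+∣∁X∣≡N) ⟩
  n * (9 * (∣ X ∣ * ∣ ∁ X ∣))          ≡⟨ cong (λ s → n * (9 * s)) (pairs≡∣X∣*∣∁X∣ X) ⟨
  n * (9 * pairs (Vec.lookup X))       ≡⟨ ring₂ n (pairs (Vec.lookup X)) ⟩
  9 * (n * pairs (Vec.lookup X))       ≤⟨ ℕ.*-monoʳ-≤ 9 (pairs≤cut-□^ G (1 + 2 * d) (pairs≤cut G deg≤d diam) k (Vec.lookup X)) ⟩
  9 * ((1 + 2 * d) * N * c)            ≤⟨ ℕ.*-monoʳ-≤ 9 (ℕ.*-monoʳ-≤ ((1 + 2 * d) * N) (cut≤cutRank (G □^ k) (degree-□^ G deg≤d k) X)) ⟩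
  9 * ((1 + 2 * d) * N * r)            ≡⟨ ring₃ d N r ⟩
  N * (9 * ((1 + 2 * d) * r))          ∎)
  where
  open ℕ.≤-Reasoning
  N = n ^ k
  c = cut (G □^ k) (Vec.lookup X)
  r = cutRank (G □^ k) X * (k * d * (k * d))
  ∣X∣+∣∁X∣≡N : ∣ X ∣ + ∣ ∁ X ∣ ≡ N
  ∣X∣+∣∁X∣≡N = trans (cong (_+_ ∣ X ∣) (∣∁p∣≡n∸∣p∣ X)) (ℕ.m+[n∸m]≡n (∣p∣≤n X))
  ring₁ : ∀ n N → N * (2 * (n * N)) ≡ n * (2 * (N * N))
  ring₁ = ℕ-Solver.solve-∀
  ring₂ : ∀ n s → n * (9 * s) ≡ 9 * (n * s)
  ring₂ = ℕ-Solver.solve-∀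
  ring₃ : ∀ d N r → 9 * ((1 + 2 * d) * N * r) ≡ N * (9 * ((1 + 2 * d) * r))
  ring₃ = ℕ-Solver.solve-∀

petersen-cutRank : ∀ k (X : Subset (10 ^ k)) → 10 ^ k ℕ.≤ 3 * ∣ X ∣ → 10 ^ k ℕ.≤ 3 * ∣ ∁ X ∣ →
                   2 * 10 ^ k ℕ.≤ cutRank (petersen □^ k) X * (81 * k ^ 2)
petersen-cutRank k X N≤3x N≤3y = arithmetic (10 ^ k) (cutRank (petersen □^ k) X)
  (cutRank-lowerBound petersen petersen-degree petersen-diameter k X N≤3x N≤3y)
  where
  open ℕ.≤-Reasoning
  ring₁ : ∀ N → 10 * (2 * N) ≡ 2 * (10 * N)
  ring₁ = ℕ-Solver.solve-∀
  ring₂ : ∀ r k → 9 * (7 * (r * (k * 3 * (k * 3)))) ≡ 7 * (r * (81 * (k * (k * 1))))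
  ring₂ = ℕ-Solver.solve-∀
  arithmetic : ∀ N r → 2 * (10 * N) ℕ.≤ 9 * (7 * (r * (k * 3 * (k * 3)))) → 2 * N ℕ.≤ r * (81 * k ^ 2)
  arithmetic N r h = ℕ.*-cancelˡ-≤ 10 (begin
    10 * (2 * N)                          ≡⟨ ring₁ N ⟩
    2 * (10 * N)                          ≤⟨ h ⟩
    9 * (7 * (r * (k * 3 * (k * 3))))     ≡⟨ ring₂ r k ⟩
    -- The path constant 7 = 1 + 2 · 3 is rounded up to the 10 on the left-hand side, which cancels;
    -- this trades 20/567 for 2/81.
    7 * (r * (81 * k ^ 2))                ≤⟨ ℕ.*-monoˡ-≤ (r * (81 * k ^ 2)) (ℕ.m≤m+n 7 3) ⟩
    10 * (r * (81 * k ^ 2))               ∎)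

petersen-width : ∀ k .{{_ : NonTrivial k}} (D : RankDecomposition (petersen □^ k)) →
                 2 * 10 ^ k ℕ.≤ RankDecomposition.width D * (81 * k ^ 2)
petersen-width k D = fromCut (balancedCut D 2≤N)
  where
  open RankDecomposition D
  2≤N : 2 ℕ.≤ 10 ^ k
  2≤N = ℕ.≤-trans (s≤s (s≤s z≤n)) (ℕ.^-monoʳ-≤ 10 (ℕ.<⇒≤ (nonTrivial⇒n>1 k)))
  fromCut : BalancedCut D → 2 * 10 ^ k ℕ.≤ width * (81 * k ^ 2)
  fromCut (e , e∈ , N≤3x , N≤3y) = ℕ.≤-trans (petersen-cutRank k (side e) N≤3x N≤3y)
    (ℕ.*-monoˡ-≤ (81 * k ^ 2) (cutRank≤width D e∈))

-- Transfer of the bound from natural to rational numbers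

toℚᵘ-/ : ∀ n d .{{_ : NonZero d}} → toℚᵘ (ℤ.+ n ℚ./ d) ℚᵘ.≃ (ℤ.+ n ℚᵘ./ d)
toℚᵘ-/ n (suc d) = ℚ.toℚᵘ-fromℚᵘ (mkℚᵘ (ℤ.+ n) d)

positive-↥ : ∀ x .{{_ : Positive x}} → ↥ x ≡ ℤ.+ ℤ.∣ ↥ x ∣
positive-↥ (mkℚ (ℤ.+ suc _) _ _) = refl

unpack : ∀ x {i d} → toℚᵘ x ℚᵘ.≃ mkℚᵘ i d → ↥ x ℤ.* ℤ.+ suc d ≡ i ℤ.* ↧ x
unpack record{} (*≡* eq) = eq

-- x = u / v, not necessarily in lowest terms, for positive x.
Fraction : (x : ℚ) → ℕ → ℕ → Set
Fraction x u v = ℤ.∣ ↥ x ∣ * v ≡ u * ↧ₙ x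

fraction : ∀ x .{{_ : Positive x}} {u v} .{{_ : NonZero v}} → toℚᵘ x ℚᵘ.≃ (ℤ.+ u ℚᵘ./ v) → Fraction x u v
fraction x {u} {suc v} x≃ = ℤ.+-injective (begin
  ℤ.+ (ℤ.∣ ↥ x ∣ * suc v)         ≡⟨ ℤ.pos-* ℤ.∣ ↥ x ∣ (suc v) ⟩
  ℤ.+ ℤ.∣ ↥ x ∣ ℤ.* ℤ.+ suc v     ≡⟨ cong (ℤ._* ℤ.+ suc v) (positive-↥ x) ⟨
  ↥ x ℤ.* ℤ.+ suc v               ≡⟨ unpack x x≃ ⟩
  ℤ.+ u ℤ.* ↧ x                   ≡⟨ ℤ.pos-* u (↧ₙ x) ⟨
  ℤ.+ (u * ↧ₙ x)                  ∎)
  where open ≡-Reasoning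

fraction-ℕ→ℚ : ∀ n .{{_ : Positive (ℕ→ℚ n)}} → Fraction (ℕ→ℚ n) n 1
fraction-ℕ→ℚ n = fraction (ℕ→ℚ n) (toℚᵘ-/ n 1)

fraction-bound : ∀ k .{{_ : NonTrivial k}} → Fraction (bound k) (2 * 10 ^ k) (81 * k ^ 2)
fraction-bound k = fraction (bound k) {{bound-positive k}} {2 * 10 ^ k} {81 * k ^ 2} {{ℕ.m*n≢0 81 (k ^ 2)}} (begin
  toℚᵘ (bound k)                                            ≈⟨ ℚ.toℚᵘ-homo-* (ℤ.+ 2 ℚ./ 81) (ℤ.+ (10 ^ k) ℚ./ k ^ 2) ⟩
  mkℚᵘ (ℤ.+ 2) 80 ℚᵘ.* toℚᵘ (ℤ.+ (10 ^ k) ℚ./ k ^ 2)        ≈⟨ ℚᵘ.*-congˡ {mkℚᵘ (ℤ.+ 2) 80} (toℚᵘ-/ (10 ^ k) (k ^ 2)) ⟩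
  mkℚᵘ (ℤ.+ 2) 80 ℚᵘ.* (ℤ.+ (10 ^ k) ℚᵘ./ k ^ 2)            ≈⟨ product (10 ^ k) (k ^ 2) ⟩
  (ℤ.+ (2 * 10 ^ k) ℚᵘ./ (81 * k ^ 2)) {{ℕ.m*n≢0 81 (k ^ 2)}}  ∎)
  where
  open ℚᵘ.≃-Reasoning
  instance
    k²≢0 : NonZero (k ^ 2)
    k²≢0 = ℕ.m^n≢0 k 2 {{nonTrivial⇒nonZero k}}
  product : ∀ a b .{{_ : NonZero b}} → mkℚᵘ (ℤ.+ 2) 80 ℚᵘ.* (ℤ.+ a ℚᵘ./ b) ℚᵘ.≃ (ℤ.+ (2 * a) ℚᵘ./ (81 * b)) {{ℕ.m*n≢0 81 b}}
  product a (suc b) = *≡* (cong (ℤ._* ℤ.+ (81 * suc b)) (sym (ℤ.pos-* 2 a)))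

fraction-≤ : ∀ x .{{_ : Positive x}} {u v r} .{{_ : NonZero v}} → Fraction x u v → u ℕ.≤ r * v → x ≤ ℕ→ℚ r
fraction-≤ x {u} {v} {r} frac u≤rv = ℚ.toℚᵘ-cancel-≤ (ℚᵘ.≤-respʳ-≃ (ℚᵘ.≃-sym (toℚᵘ-/ r 1)) (integral x numerator))
  where
  integral : ∀ x → ↥ x ℤ.≤ ℤ.+ r ℤ.* ↧ x → toℚᵘ x ℚᵘ.≤ mkℚᵘ (ℤ.+ r) 0
  integral x@record{} h = ℚᵘ.*≤* (subst (ℤ._≤ ℤ.+ r ℤ.* ↧ x) (sym (ℤ.*-identityʳ _)) h)
  open ℕ.≤-Reasoning
  ring : ∀ a b c → a * b * c ≡ a * c * b
  ring = ℕ-Solver.solve-∀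
  numerator : ↥ x ℤ.≤ ℤ.+ r ℤ.* ↧ x
  numerator = subst₂ ℤ._≤_ (sym (positive-↥ x)) (ℤ.pos-* r (↧ₙ x)) (ℤ.+≤+ (ℕ.*-cancelʳ-≤ _ _ v (begin
    ℤ.∣ ↥ x ∣ * v    ≡⟨ frac ⟩
    u * ↧ₙ x         ≤⟨ ℕ.*-monoˡ-≤ (↧ₙ x) u≤rv ⟩
    r * v * ↧ₙ x     ≡⟨ ring r v (↧ₙ x) ⟩
    r * ↧ₙ x * v     ∎)))

rankWidth-bound : ∀ k .{{_ : NonTrivial k}} r → IsRankWidth (petersen □^ k) r → bound k ≤ ℕ→ℚ r
rankWidth-bound k r ((D , width≡r) , _) =
  fraction-≤ (bound k) {{bound-positive k}} {r = r} {{ℕ.m*n≢0 81 (k ^ 2) {{_}} {{ℕ.m^n≢0 k 2 {{nonTrivial⇒nonZero k}}}}}} (fraction-bound k)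
    (subst (λ w → 2 * 10 ^ k ℕ.≤ w * (81 * k ^ 2)) width≡r (petersen-width k D))

-- The exponent

-- q = (m − m′) / d, not necessarily in lowest terms.
Exponent : ℚ → ℕ → ℕ → ℕ → Set
Exponent q m m′ d = ↥ q ℤ.* ℤ.+ d ≡ (ℤ.+ m ℤ.- ℤ.+ m′) ℤ.* ↧ q

-- `PowerBelow` and `PowerAbove` read numerators and denominators in lowest terms, which do not
-- compute for a variable `k`. Here the comparison of b^q with x is moved to arbitrary
-- representatives x = u / v and q = (m - m′) / d.
module Powers (b : ℕ) .(1<b : 1 ℕ.< b) (x : ℚ) .{{_ : Positive x}} (u v : ℕ) .{{_ : NonZero v}} (x≡u/v : Fraction x u v) where
  private
    1<b′ : 1 ℕ.< b
    1<b′ = nonTrivial⇒n>1 b {{n>1⇒nonTrivial 1<b}}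
    ux vx : ℕ
    ux = ℤ.∣ ↥ x ∣
    vx = ↧ₙ x
  open Compare b 1<b′ ux vx (numerator-nonZero x) _

  private
    u^·v^ : ∀ d → ux ^ d * v ^ d ≡ u ^ d * vx ^ d
    u^·v^ d = trans (sym (^-distrib-* ux v d)) (trans (cong (_^ d) x≡u/v) (^-distrib-* u vx d))

    swap-last : ∀ a b c → a * b * c ≡ a * c * b
    swap-last = ℕ-Solver.solve-∀

    scaledX : ∀ m d → X m d * v ^ d ≡ b ^ m * v ^ d * vx ^ d
    scaledX m d = swap-last (b ^ m) (vx ^ d) (v ^ d)

    scaledY : ∀ m d → Y m d * v ^ d ≡ u ^ d * b ^ m * vx ^ d
    scaledY m d = begin
      ux ^ d * b ^ m * v ^ d   ≡⟨ swap-last (ux ^ d) (b ^ m) (v ^ d) ⟩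
      ux ^ d * v ^ d * b ^ m   ≡⟨ cong (_* b ^ m) (u^·v^ d) ⟩
      u ^ d * vx ^ d * b ^ m   ≡⟨ swap-last (u ^ d) (vx ^ d) (b ^ m) ⟩
      u ^ d * b ^ m * vx ^ d   ∎
      where open ≡-Reasoning

  module _ q m m′ d .{{_ : NonZero d}} (q≡ : Exponent q m m′ d) where
    private
      p⁺ p⁻ e : ℕ
      p⁺ = (↥ q) ⁺
      p⁻ = (↥ q) ⁻
      e = ↧ₙ q

      to-≤ : p⁺ * d + m′ * e ℕ.≤ m * e + p⁻ * d
      to-≤ = cross-≤ p⁺ p⁻ d m m′ e (ℤ.≤-reflexive (trans (cong (ℤ._* ℤ.+ d) (normal-≡ q)) q≡))

      from-≤ : m * e + p⁻ * d ℕ.≤ p⁺ * d + m′ * e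
      from-≤ = cross-≤ m m′ e p⁺ p⁻ d (ℤ.≤-reflexive (sym (trans (cong (ℤ._* ℤ.+ d) (normal-≡ q)) q≡)))

    below⇒ : PowerBelow b q x → b ^ m * v ^ d ℕ.< u ^ d * b ^ m′
    below⇒ below = ℕ.*-cancelʳ-< (vx ^ d) _ _ (subst₂ ℕ._<_ (scaledX m d) (scaledY m′ d)
      (ℕ.*-monoˡ-< (v ^ d) {{ℕ.m^n≢0 v d}} (below-down m m′ d p⁺ p⁻ e from-≤ below)))

    ⇒below : b ^ m * v ^ d ℕ.< u ^ d * b ^ m′ → PowerBelow b q x
    ⇒below h = below-down p⁺ p⁻ e m m′ d to-≤
      (ℕ.*-cancelʳ-< (v ^ d) _ _ (subst₂ ℕ._<_ (sym (scaledX m d)) (sym (scaledY m′ d))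
        (ℕ.*-monoˡ-< (vx ^ d) {{ℕ.m^n≢0 vx d}} h)))

    above⇒ : PowerAbove b q x → u ^ d * b ^ m′ ℕ.< b ^ m * v ^ d
    above⇒ above = ℕ.*-cancelʳ-< (vx ^ d) _ _ (subst₂ ℕ._<_ (scaledY m′ d) (scaledX m d)
      (ℕ.*-monoˡ-< (v ^ d) {{ℕ.m^n≢0 v d}} (above-up p⁺ p⁻ e m m′ d to-≤ above)))

    ⇒above : u ^ d * b ^ m′ ℕ.< b ^ m * v ^ d → PowerAbove b q x
    ⇒above h = above-up m m′ d p⁺ p⁻ e from-≤
      (ℕ.*-cancelʳ-< (v ^ d) _ _ (subst₂ ℕ._<_ (sym (scaledY m′ d)) (sym (scaledX m d))
        (ℕ.*-monoˡ-< (vx ^ d) {{ℕ.m^n≢0 vx d}} h)))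

exponent-1- : ∀ q p⁺ p⁻ → ℤ.+ p⁺ ℤ.- ℤ.+ p⁻ ≡ ↥ q → Exponent (1ℚ ℚ.- q) (↧ₙ q + p⁻) p⁺ (↧ₙ q)
exponent-1- q@record{} p⁺ p⁻ p≡ = begin
  ↥ (1ℚ ℚ.- q) ℤ.* ↧ q                                      ≡⟨ cong (λ d → ↥ (1ℚ ℚ.- q) ℤ.* ℤ.+ d) (ℕ.*-identityˡ (↧ₙ q)) ⟨
  ↥ (1ℚ ℚ.- q) ℤ.* ℤ.+ (1 * ↧ₙ q)                           ≡⟨ unpack (1ℚ ℚ.- q) 1-q≃ ⟩
  (ℤ.1ℤ ℤ.* ↧ q ℤ.+ ℤ.- ↥ q ℤ.* ℤ.1ℤ) ℤ.* ↧ (1ℚ ℚ.- q)      ≡⟨ cong (ℤ._* ↧ (1ℚ ℚ.- q)) numerator ⟩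
  (ℤ.+ (↧ₙ q + p⁻) ℤ.- ℤ.+ p⁺) ℤ.* ↧ (1ℚ ℚ.- q) ∎
  where
  open ≡-Reasoning
  1-q≃ : toℚᵘ (1ℚ ℚ.- q) ℚᵘ.≃ ℚᵘ.1ℚᵘ ℚᵘ.- toℚᵘ q
  1-q≃ = ℚᵘ.≃-trans (ℚ.toℚᵘ-homo-+ 1ℚ (ℚ.- q)) (ℚᵘ.+-congʳ ℚᵘ.1ℚᵘ (ℚ.toℚᵘ-homo‿- q))
  ring : ∀ d p m → ℤ.1ℤ ℤ.* d ℤ.+ ℤ.- (p ℤ.- m) ℤ.* ℤ.1ℤ ≡ d ℤ.+ m ℤ.- p
  ring = ℤ-Solver.solve-∀
  numerator : ℤ.1ℤ ℤ.* ↧ q ℤ.+ ℤ.- ↥ q ℤ.* ℤ.1ℤ ≡ ℤ.+ (↧ₙ q + p⁻) ℤ.- ℤ.+ p⁺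
  numerator = trans (cong (λ p → ℤ.1ℤ ℤ.* ↧ q ℤ.+ ℤ.- p ℤ.* ℤ.1ℤ) (sym p≡))
    (ring (↧ q) (ℤ.+ p⁺) (ℤ.+ p⁻))

÷-*-cancel : ∀ q c .{{_ : ℚ.NonZero c}} → (q ℚ.÷ c) ℚ.* c ≡ q
÷-*-cancel q c = trans (ℚ.*-assoc q _ c) (trans (cong (q ℚ.*_) (ℚ.*-inverseˡ c)) (ℚ.*-identityʳ q))

private
  cross-product : ∀ s q c k → s ℚ.* (ℤ.+ 1 ℚ./ suc k) ℚ.* c ≡ q →
                  ↥ s ℤ.* ↥ c ℤ.* ↧ q ≡ ↥ q ℤ.* (↧ s ℤ.* ℤ.+ suc k ℤ.* ↧ c)
  cross-product s@record{} q@record{} c@record{} k eq with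
    ℚᵘ.≃-trans (ℚᵘ.≃-sym (ℚᵘ.≃-trans (ℚ.toℚᵘ-homo-* (s ℚ.* (ℤ.+ 1 ℚ./ suc k)) c)
      (ℚᵘ.*-congʳ {toℚᵘ c} (ℚᵘ.≃-trans (ℚ.toℚᵘ-homo-* s (ℤ.+ 1 ℚ./ suc k)) (ℚᵘ.*-congˡ {toℚᵘ s} (toℚᵘ-/ 1 (suc k)))))))
      (ℚ.toℚᵘ-cong eq)
  ... | *≡* h = begin
    ↥ s ℤ.* ↥ c ℤ.* ↧ q                                ≡⟨ cong (λ i → i ℤ.* ↥ c ℤ.* ↧ q) (ℤ.*-identityʳ (↥ s)) ⟨
    ↥ s ℤ.* ℤ.1ℤ ℤ.* ↥ c ℤ.* ↧ q                       ≡⟨ h ⟩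
    ↥ q ℤ.* ℤ.+ (↧ₙ s * suc k * ↧ₙ c)                  ≡⟨ cong (↥ q ℤ.*_) (trans (ℤ.pos-* (↧ₙ s * suc k) (↧ₙ c)) (cong (ℤ._* ↧ c) (ℤ.pos-* (↧ₙ s) (suc k)))) ⟩
    ↥ q ℤ.* (↧ s ℤ.* ℤ.+ suc k ℤ.* ↧ c)                ∎
    where open ≡-Reasoning

-- This is s = kq / c. The hypothesis keeps it in multiplied form, so that no reciprocal has to be
-- inspected in lowest terms.
exponent-scaled : ∀ s q c k .{{_ : Positive c}} .{{_ : NonZero k}} p⁺ p⁻ → ℤ.+ p⁺ ℤ.- ℤ.+ p⁻ ≡ ↥ q →
  s ℚ.* (ℤ.+ 1 ℚ./ k) ℚ.* c ≡ q → Exponent s (↧ₙ c * (k * p⁺)) (↧ₙ c * (k * p⁻)) (ℤ.∣ ↥ c ∣ * ↧ₙ q)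
exponent-scaled s q c k@(suc n) p⁺ p⁻ p≡ eq = begin
  ↥ s ℤ.* ℤ.+ (ℤ.∣ ↥ c ∣ * ↧ₙ q)             ≡⟨ cong (↥ s ℤ.*_) (ℤ.pos-* ℤ.∣ ↥ c ∣ (↧ₙ q)) ⟩
  ↥ s ℤ.* (ℤ.+ ℤ.∣ ↥ c ∣ ℤ.* ↧ q)            ≡⟨ cong (λ i → ↥ s ℤ.* (i ℤ.* ↧ q)) (positive-↥ c) ⟨
  ↥ s ℤ.* (↥ c ℤ.* ↧ q)                      ≡⟨ ℤ.*-assoc (↥ s) (↥ c) (↧ q) ⟨
  ↥ s ℤ.* ↥ c ℤ.* ↧ q                        ≡⟨ cross-product s q c n eq ⟩
  ↥ q ℤ.* (↧ s ℤ.* ℤ.+ k ℤ.* ↧ c)            ≡⟨ cong (ℤ._* (↧ s ℤ.* ℤ.+ k ℤ.* ↧ c)) p≡ ⟨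
  (ℤ.+ p⁺ ℤ.- ℤ.+ p⁻) ℤ.* (↧ s ℤ.* ℤ.+ k ℤ.* ↧ c)  ≡⟨ ring (ℤ.+ p⁺) (ℤ.+ p⁻) (↧ s) (ℤ.+ k) (↧ c) ⟩
  (↧ c ℤ.* (ℤ.+ k ℤ.* ℤ.+ p⁺) ℤ.- ↧ c ℤ.* (ℤ.+ k ℤ.* ℤ.+ p⁻)) ℤ.* ↧ s
                                             ≡⟨ cong₂ (λ i j → (i ℤ.- j) ℤ.* ↧ s) (pos-** p⁺) (pos-** p⁻) ⟨
  (ℤ.+ (↧ₙ c * (k * p⁺)) ℤ.- ℤ.+ (↧ₙ c * (k * p⁻))) ℤ.* ↧ s ∎
  where
  open ≡-Reasoning
  pos-** : ∀ p → ℤ.+ (↧ₙ c * (k * p)) ≡ ↧ c ℤ.* (ℤ.+ k ℤ.* ℤ.+ p)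
  pos-** p = trans (ℤ.pos-* (↧ₙ c) (k * p)) (cong (↧ c ℤ.*_) (ℤ.pos-* k p))
  ring : ∀ p m s k c → (p ℤ.- m) ℤ.* (s ℤ.* k ℤ.* c) ≡ (c ℤ.* (k ℤ.* p) ℤ.- c ℤ.* (k ℤ.* m)) ℤ.* s
  ring = ℤ-Solver.solve-∀

-- Comparison of powers of 2, 10 and k

module Numeric (k : ℕ) (2≤k : 2 ℕ.≤ k) (d : ℕ) .{{_ : NonZero d}} where
  open ℕ.≤-Reasoning
  private
    B : ℕ
    B = 10 ^ k
    instance
      k≢0 : NonZero k
      k≢0 = ℕ.>-nonZero (ℕ.<-trans (s≤s z≤n) 2≤k)
      B≢0 : NonZero B
      B≢0 = ℕ.m^n≢0 10 k
      B^d≢0 : NonZero (B ^ d)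
      B^d≢0 = ℕ.m^n≢0 B d

    factor : ∀ m → (2 * B) ^ d * B ^ m ≡ B ^ d * (2 ^ d * B ^ m)
    factor m = trans (cong (_* B ^ m) (^-distrib-* 2 B d)) (ring (2 ^ d) (B ^ d) (B ^ m))
      where
      ring : ∀ a b c → a * b * c ≡ b * (a * c)
      ring = ℕ-Solver.solve-∀

    denominator : (81 * k ^ 2) ^ d ≡ 81 ^ d * (k ^ d) ^ 2
    denominator = trans (^-distrib-* 81 (k ^ 2) d) (cong (81 ^ d *_)
      (trans (ℕ.^-*-assoc k 2 d) (trans (cong (k ^_) (ℕ.*-comm 2 d)) (sym (ℕ.^-*-assoc k d 2)))))

  -- For q = m / d ≥ 0 the hypothesis says 2^(2km) < k^d, that is q < ½ · log₂ k / k. Squared, and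
  -- with 10 ≤ 2⁴, it gives B^m < k^(2d). The trivial factors and exponents are the shape in which
  -- `below⇒` delivers it.
  square-below⇒above : ∀ m → 2 ^ (2 * (k * m)) * 1 ^ (1 * d) ℕ.< k ^ (1 * d) * 2 ^ (2 * (k * 0)) →
                       (2 * B) ^ d * B ^ m ℕ.< B ^ (d + 0) * (81 * k ^ 2) ^ d
  square-below⇒above m h = begin-strict
    (2 * B) ^ d * B ^ m                ≡⟨ factor m ⟩
    B ^ d * (2 ^ d * B ^ m)            ≤⟨ ℕ.*-monoʳ-≤ (B ^ d) (ℕ.*-mono-≤ (ℕ.^-monoˡ-≤ d (ℕ.m≤m+n 2 79)) B^m≤) ⟩
    B ^ d * (81 ^ d * A ^ 2)           <⟨ ℕ.*-monoʳ-< (B ^ d) (ℕ.*-monoʳ-< (81 ^ d) {{ℕ.m^n≢0 81 d}} (ℕ.^-monoˡ-< 2 A<k^d)) ⟩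
    B ^ d * (81 ^ d * (k ^ d) ^ 2)     ≡⟨ cong₂ _*_ (cong (B ^_) (ℕ.+-identityʳ d)) denominator ⟨
    B ^ (d + 0) * (81 * k ^ 2) ^ d     ∎
    where
    A = 2 ^ (2 * (k * m))
    A<k^d : A ℕ.< k ^ d
    A<k^d = subst₂ ℕ._<_
      (trans (cong (A *_) (ℕ.^-zeroˡ (1 * d))) (ℕ.*-identityʳ A))
      (trans (cong₂ (λ e z → k ^ e * 2 ^ (2 * z)) (ℕ.*-identityˡ d) (ℕ.*-zeroʳ k)) (ℕ.*-identityʳ (k ^ d))) h
    ring : ∀ n → 4 * n ≡ 2 * n * 2
    ring = ℕ-Solver.solve-∀
    B^m≤ : B ^ m ℕ.≤ A ^ 2
    B^m≤ = begin
      B ^ m                  ≡⟨ ℕ.^-*-assoc 10 k m ⟩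
      10 ^ (k * m)           ≤⟨ ℕ.^-monoˡ-≤ (k * m) (ℕ.m≤m+n 10 6) ⟩
      (2 ^ 4) ^ (k * m)      ≡⟨ ℕ.^-*-assoc 2 4 (k * m) ⟩
      2 ^ (4 * (k * m))      ≡⟨ cong (2 ^_) (ring (k * m)) ⟩
      2 ^ (2 * (k * m) * 2)  ≡⟨ ℕ.^-*-assoc 2 (2 * (k * m)) 2 ⟨
      A ^ 2                  ∎

  -- This serves negative q, where positivity of the deficit suffices: 2 < 81k².
  above : ∀ m → (2 * B) ^ d * B ^ 0 ℕ.< B ^ (d + m) * (81 * k ^ 2) ^ d
  above m = begin-strict
    (2 * B) ^ d * 1                    ≡⟨ factor 0 ⟩
    B ^ d * (2 ^ d * 1)                <⟨ ℕ.*-monoʳ-< (B ^ d) (ℕ.*-monoˡ-< 1 (ℕ.^-monoˡ-< d (ℕ.m≤m+n 3 78))) ⟩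
    B ^ d * (81 ^ d * 1)               ≤⟨ ℕ.*-mono-≤ (ℕ.^-monoʳ-≤ B (ℕ.m≤m+n d m)) (ℕ.*-monoʳ-≤ (81 ^ d) (ℕ.m^n>0 (k ^ d) {{ℕ.m^n≢0 k d}} 2)) ⟩
    B ^ (d + m) * (81 ^ d * (k ^ d) ^ 2) ≡⟨ cong (B ^ (d + m) *_) denominator ⟨
    B ^ (d + m) * (81 * k ^ 2) ^ d     ∎

  above⇒eighth-below : ∀ m → (2 * B) ^ d * B ^ m ℕ.< B ^ (d + 0) * (81 * k ^ 2) ^ d →
                       2 ^ (1 * (k * m)) * 1 ^ (8 * d) ℕ.< k ^ (8 * d) * 2 ^ (1 * (k * 0))
  above⇒eighth-below m h = begin-strict
    2 ^ (1 * (k * m)) * 1 ^ (8 * d)    ≡⟨ trans (cong₂ (λ e z → 2 ^ e * z) (ℕ.*-identityˡ (k * m)) (ℕ.^-zeroˡ (8 * d))) (ℕ.*-identityʳ _) ⟩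
    2 ^ (k * m)                        ≤⟨ ℕ.^-monoˡ-≤ (k * m) (ℕ.m≤m+n 2 8) ⟩
    10 ^ (k * m)                       ≡⟨ ℕ.^-*-assoc 10 k m ⟨
    B ^ m                              <⟨ ℕ.*-cancelˡ-< (2 ^ d) _ _ 2^d·B^m< ⟩
    (k ^ 8) ^ d                        ≡⟨ ℕ.^-*-assoc k 8 d ⟩
    k ^ (8 * d)                        ≡⟨ trans (cong (λ z → k ^ (8 * d) * 2 ^ (1 * z)) (ℕ.*-zeroʳ k)) (ℕ.*-identityʳ _) ⟨
    k ^ (8 * d) * 2 ^ (1 * (k * 0))    ∎
    where
    81k²≤ : 81 * k ^ 2 ℕ.≤ 2 * k ^ 8
    81k²≤ = begin
      -- The 81 is raised to 128 = 2 · 2⁶, so that 2 ≤ k turns 2⁶ into k⁶ and the remaining 2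
      -- matches the 2 in `bound`.
      81 * k ^ 2             ≤⟨ ℕ.*-monoˡ-≤ (k ^ 2) (ℕ.m≤m+n 81 47) ⟩
      2 * 2 ^ 6 * k ^ 2      ≡⟨ ℕ.*-assoc 2 (2 ^ 6) (k ^ 2) ⟩
      2 * (2 ^ 6 * k ^ 2)    ≤⟨ ℕ.*-monoʳ-≤ 2 (ℕ.*-monoˡ-≤ (k ^ 2) (ℕ.^-monoˡ-≤ 6 2≤k)) ⟩
      2 * (k ^ 6 * k ^ 2)    ≡⟨ cong (2 *_) (ℕ.^-distribˡ-+-* k 6 2) ⟨
      2 * k ^ 8              ∎
    2^d·B^m< : 2 ^ d * B ^ m ℕ.< 2 ^ d * (k ^ 8) ^ d
    2^d·B^m< = ℕ.*-cancelˡ-< (B ^ d) _ _ (begin-strict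
      B ^ d * (2 ^ d * B ^ m)          ≡⟨ factor m ⟨
      (2 * B) ^ d * B ^ m              <⟨ h ⟩
      B ^ (d + 0) * (81 * k ^ 2) ^ d   ≤⟨ ℕ.*-mono-≤ (ℕ.≤-reflexive (cong (B ^_) (ℕ.+-identityʳ d))) (ℕ.^-monoˡ-≤ d 81k²≤) ⟩
      B ^ d * (2 * k ^ 8) ^ d          ≡⟨ cong (B ^ d *_) (^-distrib-* 2 (k ^ 8) d) ⟩
      B ^ d * (2 ^ d * (k ^ 8) ^ d)    ∎)

  -- For negative q it is enough that log₂ k is positive, that is 1 < k.
  eighth-below : ∀ m → 2 ^ (1 * (k * 0)) * 1 ^ (8 * d) ℕ.< k ^ (8 * d) * 2 ^ (1 * (k * m))
  eighth-below m = begin-strict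
    2 ^ (1 * (k * 0)) * 1 ^ (8 * d)    ≡⟨ cong₂ (λ z w → 2 ^ (1 * z) * w) (ℕ.*-zeroʳ k) (ℕ.^-zeroˡ (8 * d)) ⟩
    1                                  ≡⟨ ℕ.^-zeroˡ (8 * d) ⟨
    1 ^ (8 * d)                        <⟨ ℕ.^-monoˡ-< (8 * d) {{ℕ.m*n≢0 8 d}} 2≤k ⟩
    k ^ (8 * d)                        ≤⟨ ℕ.m≤m*n (k ^ (8 * d)) (2 ^ (1 * (k * m))) {{ℕ.m^n≢0 2 (1 * (k * m))}} ⟩
    k ^ (8 * d) * 2 ^ (1 * (k * m))    ∎

1<10^ : ∀ k .{{_ : NonTrivial k}} → 1 ℕ.< 10 ^ k
1<10^ k = ℕ.≤-trans (ℕ.m≤m+n 2 98) (ℕ.^-monoʳ-≤ 10 (nonTrivial⇒n>1 k))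

-- The base-10^k logarithm of 81 k² / 2.
deficit : Sequence
deficit k = 1- log (10 ^ k) {{n>1⇒nonTrivial (1<10^ k)}} (bound k) {{bound-positive k}}

1-1- : ∀ q → 1ℚ ℚ.- (1ℚ ℚ.- q) ≡ q
1-1- = solve 1 (λ q → con 1ℚ :- (con 1ℚ :- q) := q) refl
  where open +-*-Solver

-- The cuts of `log` are by definition the conditions in `IsPower`; reflecting twice by `1-_` only
-- replaces q by 1 - (1 - q).
bound-isPower : ∀ k .{{_ : NonTrivial k}} → IsPower (bound k) {{bound-positive k}} (10 ^ k) (1- deficit k)
bound-isPower k =
    (λ {q} → subst (λ q → PowerBelow (10 ^ k) q (bound k) {{bound-positive k}}) (1-1- q))
  , (λ {q} → subst (λ q → PowerAbove (10 ^ k) q (bound k) {{bound-positive k}}) (1-1- q))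

module _ (k : ℕ) .{{_ : NonTrivial k}} where
  private instance
    k≢0 : NonZero k
    k≢0 = nonTrivial⇒nonZero k
    k⁺ : Positive (ℕ→ℚ k)
    k⁺ = ℚ.normalize-pos k 1
    bound⁺ : Positive (bound k)
    bound⁺ = bound-positive k
    1/k⁺ : Positive (ℤ.+ 1 ℚ./ k)
    1/k⁺ = ℚ.normalize-pos 1 k
    1/k≢0 : ℚ.NonZero (ℤ.+ 1 ℚ./ k)
    1/k≢0 = ℚ.pos⇒nonZero (ℤ.+ 1 ℚ./ k)
    81k²≢0 : NonZero (81 * k ^ 2)
    81k²≢0 = ℕ.m*n≢0 81 (k ^ 2) {{_}} {{ℕ.m^n≢0 k 2}}

  open Powers 2 (s≤s (s≤s z≤n)) (ℕ→ℚ k) k 1 (fraction-ℕ→ℚ k)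
  open Powers (10 ^ k) (1<10^ k) (bound k) (2 * 10 ^ k) (81 * k ^ 2) (fraction-bound k)
    using () renaming (⇒above to ⇒above-bound; above⇒ to above-bound⇒)

  module _ (c : ℚ) .{{_ : Positive c}} (q : ℚ) where
    private instance
      c≢0 : ℚ.NonZero c
      c≢0 = ℚ.pos⇒nonZero c

    -- k q / c: by definition, q < c · logk/k k amounts to logExponent < log₂ k.
    logExponent : ℚ
    logExponent = (q ℚ.÷ c) ℚ.÷ (ℤ.+ 1 ℚ./ k)

    logExponent-≡ : ∀ p⁺ p⁻ → ℤ.+ p⁺ ℤ.- ℤ.+ p⁻ ≡ ↥ q →
                    Exponent logExponent (↧ₙ c * (k * p⁺)) (↧ₙ c * (k * p⁻)) (ℤ.∣ ↥ c ∣ * ↧ₙ q)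
    logExponent-≡ p⁺ p⁻ p≡ = exponent-scaled logExponent q c k p⁺ p⁻ p≡
      (trans (cong (ℚ._* c) (÷-*-cancel (q ℚ.÷ c) (ℤ.+ 1 ℚ./ k))) (÷-*-cancel q c))

  2≤k : 2 ℕ.≤ k
  2≤k = nonTrivial⇒n>1 k

  -- By definition of `1-_`, q is in the lower cut of `deficit k` when 1 - q is in the upper cut of
  -- the logarithm of `bound k`. The sign of q decides which natural exponents represent 1 - q.
  deficit-lower : ∀ q → PowerBelow 2 (logExponent ½ q) (ℕ→ℚ k) → PowerAbove (10 ^ k) (1ℚ ℚ.- q) (bound k)
  deficit-lower q@(mkℚ (ℤ.+ m) d-1 _) below = ⇒above-bound (1ℚ ℚ.- q) (d + 0) m d (exponent-1- q m 0 m-0)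
    (square-below⇒above m
      (below⇒ (logExponent ½ q) (2 * (k * m)) (2 * (k * 0)) (1 * d) (logExponent-≡ ½ q m 0 m-0) below))
    where
    d = suc d-1
    m-0 = ℤ.+-identityʳ (ℤ.+ m)
    open Numeric k 2≤k d using (square-below⇒above)
  deficit-lower q@(mkℚ ℤ.-[1+ n ] d-1 _) _ = ⇒above-bound (1ℚ ℚ.- q) (d + suc n) 0 d
    (exponent-1- q 0 (suc n) refl) (above (suc n))
    where
    d = suc d-1
    open Numeric k 2≤k d

  eight : ℚ
  eight = ℤ.+ 8 ℚ./ 1

  deficit-upper : ∀ q → PowerAbove (10 ^ k) (1ℚ ℚ.- q) (bound k) → PowerBelow 2 (logExponent eight q) (ℕ→ℚ k)
  deficit-upper q@(mkℚ (ℤ.+ m) d-1 _) above = ⇒below (logExponent eight q) (1 * (k * m)) (1 * (k * 0)) (8 * d)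
    (logExponent-≡ eight q m 0 m-0)
    (above⇒eighth-below m (above-bound⇒ (1ℚ ℚ.- q) (d + 0) m d (exponent-1- q m 0 m-0) above))
    where
    d = suc d-1
    m-0 = ℤ.+-identityʳ (ℤ.+ m)
    open Numeric k 2≤k d using (above⇒eighth-below)
  deficit-upper q@(mkℚ ℤ.-[1+ n ] d-1 _) _ = ⇒below (logExponent eight q) (1 * (k * 0)) (1 * (k * suc n)) (8 * d)
    (logExponent-≡ eight q 0 (suc n) refl)
    (eighth-below (suc n))
    where
    d = suc d-1
    open Numeric k 2≤k d

-- The constants come from 10 ≤ 2⁴ and, for k ≥ 2, 81 k² / 2 ≤ k⁸.
deficit-Θ : deficit ∈Θ logk/k
deficit-Θ = record { value = ½ } , record { value = ℤ.+ 8 ℚ./ 1 } , 0 , λ k _ →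
    (λ {q} → deficit-lower k q)
  , (λ {q} → deficit-upper k q)

corollary9 : (∀ (k : ℕ) .{{_ : NonTrivial k}} (r : ℕ) → IsRankWidth (petersen □^ k) r → bound k ≤ ℕ→ℚ r)
    × (Σ[ θ ∈ Sequence ]
    (∀ (k : ℕ) .{{_ : NonTrivial k}} → IsPower (bound k) {{bound-positive k}} (10 ^ k) (1- θ k))
    × θ ∈Θ logk/k)
corollary9 = rankWidth-bound , deficit , bound-isPower , deficit-Θ
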